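{- Suppose $\widetilde G$ is an abstract band graph with $d$ tiles that corresponds to a one-sided closed curve, with cut edge labelled $a$ and diagonal labels $i_1,\dots,i_d$, and with signs $b_T(\mathcal L_T,i_j)\in\{1,-1\}$ for $1\le j\le d$. Let $M_d$ be the associated $2\times 2$ matrix. Then its good matching enumerator is given as follows, where the sums are over all good matchings $P$ of $\widetilde G$. If $b_T(\mathcal L_T,i_d)=1$, then $$\sum_P x(P)\,y_{\mathcal L_T}(P)=x_{i_1}\cdots x_{i_d}\,\operatorname{tr}\left(\begin{bmatrix}\frac{x_a}{x_{i_d}} & x_{i_1}y_{i_d}\\ \frac1{x_{i_1}} & 0\end{bmatrix}M_d\right).$$ If $b_T(\mathcal L_T,i_d)=-1$, then $$\sum_P x(P)\,y_{\mathcal L_T}(P)=x_{i_1}\cdots x_{i_d}\,\operatorname{tr}\left(\begin{bmatrix}\frac{x_a y_{i_d}}{x_{i_d}} & x_{i_1}\\ \frac{y_{i_d}}{x_{i_1}} & 0\end{bmatrix}M_d\right).$$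
   Context: **Underlying snake graph.** Unit square tiles $G_1,\dots,G_d$ in the plane; for $1\le j\le d-1$ the tile $G_{j+1}$ is glued either directly above $G_j$ (then the parallelogram $H_j$, formed by the upper-right half of $G_j$ and the lower-left half of $G_{j+1}$, is called north-pointing) or directly to the right of $G_j$ ($H_j$ is called east-pointing). The diagonal of $G_j$ from its NW to its SE corner carries the label $i_j$; diagonals are not edges of the graph. Edge labels: if $H_j$ is north-pointing, the common edge of $G_j,G_{j+1}$ is labelled $a_j$, the East edge of $G_j$ is labelled $i_{j+1}$ and the West edge of $G_{j+1}$ is labelled $i_j$. If $H_j$ is east-pointing, the common edge is labelled $a_j$, the North edge of $G_j$ is labelled $i_{j+1}$ and the South edge of $G_{j+1}$ is labelled $i_j$. **End labels (one-sided case).** The South edge of $G_1$ is labelled $a$ and the West edge of $G_1$ is labelled $i_d$. If $d$ is odd, the North edge of $G_d$ is labelled $a'$ and the East edge of $G_d$ is labelled $i_1$; if $d$ is even, the East edge of $G_d$ is labelled $a'$ and the North edge of $G_d$ is labelled $i_1$. The band graph $\widetilde G$ is obtained by identifying the edge $a$ with the edge $a'$, so that the SW corner of $G_1$ is identified with the endpoint of $a'$ other than the NE corner of $G_d$, and the SE corner of $G_1$ with the NE corner of $G_d$; $x_{a'}=x_a$. The identified edge is called the cut edge $b$, with endpoints $x,y$. **Good matchings.** A good matching $\overline P$ of $\widetilde G$ is a perfect matching $P$ of the un-identified underlying snake graph such that one of the following holds: (i) $x$ and $y$ are matched to each other, i.e. $b\in\overline P$; (ii) $b\notin\overline P$ and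 $x$ and $y$ are matched with the two edges perpendicular to $b$ on tile $G_1$; (iii) $b\notin\overline P$ and $x$ and $y$ are matched with the two edges perpendicular to $b$ on tile $G_d$. Here $\overline P$ is the set of edges of $\widetilde G$ to which $P$ descends after removing one of $a,a'$ from $P$. **Weights.** $x_e$ ($e$ a label) and $y_{i_j}$ are commuting indeterminates; for a good matching, $x(P)$ is the product of $x_e$ over the labels $e$ of the edges of $\overline P$. The signs $b_T(\mathcal L_T,i_j)$ are the Shear coordinates, with respect to a triangulation $T$, of the principal lamination $\mathcal L_T$ at the arcs labelling the diagonals. A perfect matching $P$ of the snake graph orients every diagonal: there is a unique path from the SW corner of $G_1$ to the NE corner of $G_d$ that alternates between edges of $P$ and the diagonals; the diagonal of $G_j$ is oriented up if traversed from SE to NW and down if traversed from NW to SE. The diagonal of $G_j$ is $\mathcal L_T$-oriented if: $j$ is odd and either $b_T(\mathcal L_T,i_j)=1$ and it is oriented down, or $b_T(\mathcal L_T,i_j)=-1$ and it is oriented up; or $j$ is even and either $b_T(\mathcal L_T,i_j)=1$ and it is oriented up, or $b_T(\mathcal L_T,i_j)=-1$ and it is oriented down. Put $y_{\mathcal L_T}(P)=\prod y_{i_j}$ over all $j$ whose diagonal is $\mathcal L_T$-oriented. **Matrices.** $M_1=I_2$ and $M_d=m_{d-1}\cdots m_1$ for $d>1$. The matrix $m_1$ is of first type if $H_1$ is north-pointing, and otherwise of second type; for $j>1$, $m_j$ is of first type if $H_{j-1}$ and $H_j$ have the same shape, and otherwise of second type. If $b_T(\mathcal L_T,i_j)=1$,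 then $$m_j=\begin{bmatrix}1&0\\ \frac{x_{a_j}}{x_{i_j}x_{i_{j+1}}}&y_{i_j}\end{bmatrix}\ (\text{first type}),\qquad m_j=\begin{bmatrix}\frac{x_{i_{j+1}}}{x_{i_j}}&x_{a_j}y_{i_j}\\0&\frac{x_{i_j}y_{i_j}}{x_{i_{j+1}}}\end{bmatrix}\ (\text{second type}).$$ If $b_T(\mathcal L_T,i_j)=-1$, then $$m_j=\begin{bmatrix}y_{i_j}&0\\ \frac{x_{a_j}y_{i_j}}{x_{i_j}x_{i_{j+1}}}&1\end{bmatrix}\ (\text{first type}),\qquad m_j=\begin{bmatrix}\frac{x_{i_{j+1}}y_{i_j}}{x_{i_j}}&x_{a_j}\\0&\frac{x_{i_j}}{x_{i_{j+1}}}\end{bmatrix}\ (\text{second type}).$$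
   Formalization: Corrected, as the literal claim fails at d=3: for j>1, m_j and m_{j-1} have the same type iff H_{j-1}, H_j have different shapes; in good matchings (ii)/(iii), x and y need only be matched from the same side of the cut (P containing a or a′), not by the perpendicular edges of G_1 or G_d. -}

module Defs where

open import Algebra.Bundles using (CommutativeRing)
open import Algebra.Definitions using (Invertible)
open import Data.Fin using (Fin; zero; suc; inject₁; fromℕ; toℕ)
open import Data.Fin.Properties using (all?)
import Data.Fin.Properties as Fin
open import Data.List using (List; []; _∷_; _++_; map; filter; foldr; concatMap; mapMaybe; head; length; allFin)
import Data.List.Membership.DecPropositional as DecMembership
open import Data.List.Relation.Unary.Any using (Any; any?)
open import Data.Maybe using (Maybe; just; nothing)
open import Data.Nat using (ℕ; zero; suc; parity)
import Data.Nat.Properties as ℕ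
open import Data.Parity using (0ℙ; 1ℙ)
open import Data.Product using (_×_; _,_; proj₁; proj₂)
import Data.Product.Properties as Product
open import Data.Sign as Sign using (Sign)
open import Data.Sum using (_⊎_; inj₁; inj₂)
open import Function using (_∘_)
open import Relation.Binary.Definitions using (DecidableEquality)
open import Relation.Binary.PropositionalEquality using (_≡_; refl; cong)
open import Relation.Nullary using (¬_; Dec; yes; no; ¬?; contradiction)
open import Relation.Nullary.Decidable using (map′; _×-dec_; _⊎-dec_)

-- Throughout, the number of tiles is d = suc n.  The tile G_{j+1} is indexed
-- by j : Fin (suc n), and the parallelogram H_{j+1}, formed from G_{j+1} and
-- G_{j+2}, by j : Fin n; thus `inject₁ j` and `suc j` are its two tiles.

data Shape : Set where
  north east : Shape

-- The labels need not be pairwise distinct: a curve may cross an arc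
-- several times.
record OneSidedBand {ℓ} (Label : Set ℓ) (n : ℕ) : Set ℓ where
  field
    shape : Fin n → Shape
    diag  : Fin (suc n) → Label
    arc   : Fin n → Label
    cut   : Label

------------------------------------------------------------------------
-- The underlying snake graph

data Axis : Set where
  horizontal vertical : Axis

data Role : Set where
  common lower upper : Role

-- `first` gives the South (horizontal) and West (vertical) edges of G_1,
-- `last` the North (horizontal) and East (vertical) edges of G_d.  The other
-- edges are the sides of H_j other than the diagonals, together with the edge
-- `common` to G_j and G_{j+1}: `lower` is the East edge of G_j and `upper` the
-- West edge of G_{j+1} if H_j is north-pointing; they are the North edge of G_j
-- and the South edge of G_{j+1} if H_j is east-pointing.
data Edge (n : ℕ) : Set where
  first : Axis → Edge n
  inner : Fin n → Role → Edge n
  last  : Axis → Edge n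

-- Every vertex other than the two extreme corners is an endpoint of exactly
-- one diagonal.
data Vertex (n : ℕ) : Set where
  sw₁ : Vertex n
  nw  : Fin (suc n) → Vertex n
  se  : Fin (suc n) → Vertex n
  neₔ : Vertex n

-- The NE corner of G_j and the SW corner of G_{j+1}: gluing G_{j+1} above G_j
-- identifies SE_{j+1} = NE_j and SW_{j+1} = NW_j, gluing it to the right
-- identifies NW_{j+1} = NE_j and SW_{j+1} = SE_j.
neCorner swCorner : ∀ {n} → Shape → Fin n → Vertex n
neCorner north j = se (suc j)
neCorner east  j = nw (suc j)
swCorner north j = nw (inject₁ j)
swCorner east  j = se (inject₁ j)

glueEnds : ∀ {n} → Shape → Fin n → Role → Vertex n × Vertex n
glueEnds north j common = nw (inject₁ j) , neCorner north j
glueEnds north j lower  = se (inject₁ j) , neCorner north j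
glueEnds north j upper  = swCorner north j , nw (suc j)
glueEnds east  j common = se (inject₁ j) , neCorner east j
glueEnds east  j lower  = nw (inject₁ j) , neCorner east j
glueEnds east  j upper  = swCorner east j , se (suc j)

ends : ∀ {n} → (Fin n → Shape) → Edge n → Vertex n × Vertex n
ends s (first horizontal) = sw₁ , se zero
ends s (first vertical)   = sw₁ , nw zero
ends s (inner j r)        = glueEnds (s j) j r
ends s (last horizontal)  = nw (fromℕ _) , neₔ
ends s (last vertical)    = se (fromℕ _) , neₔ

edges : ∀ n → List (Edge n)
edges n = first horizontal ∷ first vertical
        ∷ concatMap (λ j → inner j common ∷ inner j lower ∷ inner j upper ∷ []) (allFin n)
       ++ last horizontal ∷ last vertical ∷ []

-- The edges a and a′ that are identified in the band graph.
a₁ : ∀ {n} → Edge n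
a₁ = first horizontal

cutAxis : ℕ → Axis
cutAxis d with parity d
... | 1ℙ = horizontal
... | 0ℙ = vertical

a′ : ∀ {n} → Edge n
a′ {n} = last (cutAxis (suc n))

module _ {ℓ} {Label : Set ℓ} {n : ℕ} (B : OneSidedBand Label n) where
  open OneSidedBand B

  lastLabel : Axis → Axis → Label
  lastLabel horizontal horizontal = cut
  lastLabel horizontal vertical   = diag zero
  lastLabel vertical   horizontal = diag zero
  lastLabel vertical   vertical   = cut

  label : Edge n → Label
  label (first horizontal) = cut
  label (first vertical)   = diag (fromℕ n)
  label (inner j common)   = arc j
  label (inner j lower)    = diag (suc j)
  label (inner j upper)    = diag (inject₁ j)
  label (last e)           = lastLabel (cutAxis (suc n)) e

------------------------------------------------------------------------
-- Decidable equality

_≟ᴬ_ : DecidableEquality Axis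
horizontal ≟ᴬ horizontal = yes refl
horizontal ≟ᴬ vertical   = no λ ()
vertical   ≟ᴬ horizontal = no λ ()
vertical   ≟ᴬ vertical   = yes refl

_≟ᴿ_ : DecidableEquality Role
common ≟ᴿ common = yes refl
common ≟ᴿ lower  = no λ ()
common ≟ᴿ upper  = no λ ()
lower  ≟ᴿ common = no λ ()
lower  ≟ᴿ lower  = yes refl
lower  ≟ᴿ upper  = no λ ()
upper  ≟ᴿ common = no λ ()
upper  ≟ᴿ lower  = no λ ()
upper  ≟ᴿ upper  = yes refl

_≟ᴱ_ : ∀ {n} → DecidableEquality (Edge n)
first a   ≟ᴱ first b   = map′ (cong first) (λ { refl → refl }) (a ≟ᴬ b)
first _   ≟ᴱ inner _ _ = no λ ()
first _   ≟ᴱ last _    = no λ ()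
inner _ _ ≟ᴱ first _   = no λ ()
inner j r ≟ᴱ inner k t = map′ (λ { (refl , refl) → refl }) (λ { refl → refl , refl })
                              ((j Fin.≟ k) ×-dec (r ≟ᴿ t))
inner _ _ ≟ᴱ last _    = no λ ()
last _    ≟ᴱ first _   = no λ ()
last _    ≟ᴱ inner _ _ = no λ ()
last a    ≟ᴱ last b    = map′ (cong last) (λ { refl → refl }) (a ≟ᴬ b)

_≟ⱽ_ : ∀ {n} → DecidableEquality (Vertex n)
sw₁  ≟ⱽ sw₁  = yes refl
sw₁  ≟ⱽ nw _ = no λ ()
sw₁  ≟ⱽ se _ = no λ ()
sw₁  ≟ⱽ neₔ  = no λ ()
nw _ ≟ⱽ sw₁  = no λ ()
nw j ≟ⱽ nw k = map′ (cong nw) (λ { refl → refl }) (j Fin.≟ k)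
nw _ ≟ⱽ se _ = no λ ()
nw _ ≟ⱽ neₔ  = no λ ()
se _ ≟ⱽ sw₁  = no λ ()
se _ ≟ⱽ nw _ = no λ ()
se j ≟ⱽ se k = map′ (cong se) (λ { refl → refl }) (j Fin.≟ k)
se _ ≟ⱽ neₔ  = no λ ()
neₔ  ≟ⱽ sw₁  = no λ ()
neₔ  ≟ⱽ nw _ = no λ ()
neₔ  ≟ⱽ se _ = no λ ()
neₔ  ≟ⱽ neₔ  = yes refl

module _ {n : ℕ} where
  open DecMembership (_≟ᴱ_ {n}) public using () renaming (_∈_ to _∈ᴱ_; _∈?_ to _∈ᴱ?_)

------------------------------------------------------------------------
-- Good matchings

-- All sub-lists; applied to a duplicate-free list, each subset occurs once.
sublists : ∀ {a} {A : Set a} → List A → List (List A)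
sublists []       = [] ∷ []
sublists (e ∷ es) = map (e ∷_) (sublists es) ++ sublists es

_∖_ : ∀ {n} → List (Edge n) → Edge n → List (Edge n)
P ∖ e = filter (λ f → ¬? (f ≟ᴱ e)) P

-- The edges of the band graph to which P descends, for P containing a or a′:
-- one of a, a′ is removed.  If both are in P the remaining one, a, stands for
-- the cut edge b; so b occurs in the result precisely when a does.
descend : ∀ {n} → List (Edge n) → List (Edge n)
descend P with a′ ∈ᴱ? P
... | yes _ = P ∖ a′
... | no  _ = P ∖ a₁

module _ {n : ℕ} (s : Fin n → Shape) where

  Incident : Vertex n → Edge n → Set
  Incident v e = v ≡ proj₁ (ends s e) ⊎ v ≡ proj₂ (ends s e)

  incident? : ∀ v e → Dec (Incident v e)
  incident? v e = (v ≟ⱽ proj₁ (ends s e)) ⊎-dec (v ≟ⱽ proj₂ (ends s e))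

  degree : List (Edge n) → Vertex n → ℕ
  degree P v = length (filter (incident? v) P)

  Perfect : List (Edge n) → Set
  Perfect P = ∀ v → degree P v ≡ 1

  Covers : List (Edge n) → Vertex n → Set
  Covers P v = Any (Incident v) P

  -- In the band graph the endpoint x of b comes from two vertices of the snake
  -- graph, one on G_1 and one on G_d, and so does y.
  x₁ y₁ xₔ yₔ : Vertex n
  x₁ = sw₁
  y₁ = se zero
  xₔ = proj₁ (ends s a′)
  yₔ = neₔ

  -- x and y are matched to each other; or both are matched by edges meeting
  -- the cut from the side of G_1; or both by edges meeting it from the side
  -- of G_d.  (At a vertex common to G_1 and G_2 the matching edge may be a
  -- side of G_2 only, and likewise for G_{d-1} and G_d.)
  data SameSide (P̄ : List (Edge n)) : Set where
    matched : a₁ ∈ᴱ P̄ → SameSide P̄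
    onFirst : ¬ a₁ ∈ᴱ P̄ → Covers P̄ x₁ → Covers P̄ y₁ → SameSide P̄
    onLast  : ¬ a₁ ∈ᴱ P̄ → Covers P̄ xₔ → Covers P̄ yₔ → SameSide P̄

  -- The middle condition makes `descend P` meaningful: there is an edge to
  -- remove.
  Good : List (Edge n) → Set
  Good P = Perfect P × (a₁ ∈ᴱ P ⊎ a′ ∈ᴱ P) × SameSide (descend P)

  perfect? : ∀ P → Dec (Perfect P)
  perfect? P = map′ to from
    (ok? sw₁ ×-dec (all? (ok? ∘ nw) ×-dec (all? (ok? ∘ se) ×-dec ok? neₔ)))
    where
    ok? : ∀ v → Dec (degree P v ≡ 1)
    ok? v = degree P v ℕ.≟ 1
    to : _ → Perfect P
    to (p , q , r , t) sw₁    = p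
    to (p , q , r , t) (nw j) = q j
    to (p , q , r , t) (se j) = r j
    to (p , q , r , t) neₔ    = t
    from : Perfect P → _
    from f = f sw₁ , (λ j → f (nw j)) , (λ j → f (se j)) , f neₔ

  covers? : ∀ P v → Dec (Covers P v)
  covers? P v = any? (incident? v) P

  sameSide? : ∀ P → Dec (SameSide P)
  sameSide? P with a₁ ∈ᴱ? P
  ... | yes a∈P = yes (matched a∈P)
  ... | no  a∉P = map′
    (λ { (inj₁ (p , q)) → onFirst a∉P p q ; (inj₂ (p , q)) → onLast a∉P p q })
    (λ { (matched a∈P)   → contradiction a∈P a∉P
       ; (onFirst _ p q) → inj₁ (p , q)
       ; (onLast  _ p q) → inj₂ (p , q) })
    ((covers? P x₁ ×-dec covers? P y₁) ⊎-dec (covers? P xₔ ×-dec covers? P yₔ))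

  good? : ∀ P → Dec (Good P)
  good? P = perfect? P ×-dec (((a₁ ∈ᴱ? P) ⊎-dec (a′ ∈ᴱ? P)) ×-dec sameSide? (descend P))

  goodMatchings : List (List (Edge n))
  goodMatchings = filter good? (sublists (edges n))

------------------------------------------------------------------------
-- Orientation of the diagonals

data Direction : Set where
  up down : Direction

_≟ᴰ_ : DecidableEquality Direction
up   ≟ᴰ up   = yes refl
up   ≟ᴰ down = no λ ()
down ≟ᴰ up   = no λ ()
down ≟ᴰ down = yes refl

module _ {n : ℕ} where
  open DecMembership (Product.≡-dec (Fin._≟_ {suc n}) _≟ᴰ_) public
    using () renaming (_∈?_ to _∈ᴰ?_)

module _ {n : ℕ} (s : Fin n → Shape) (P : List (Edge n)) where

  otherEnd : Vertex n → Edge n → Maybe (Vertex n)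
  otherEnd v e with v ≟ⱽ proj₁ (ends s e) | v ≟ⱽ proj₂ (ends s e)
  ... | yes _ | _     = just (proj₂ (ends s e))
  ... | no _  | yes _ = just (proj₁ (ends s e))
  ... | no _  | no _  = nothing

  partner : Vertex n → Maybe (Vertex n)
  partner v = head (mapMaybe (otherEnd v) P)

  -- Follow the edge of P at v, then the diagonal at the vertex reached, and
  -- repeat, recording the diagonals crossed; the number bounds how many.
  walk : ℕ → Vertex n → List (Fin (suc n) × Direction)
  walk zero    v = []
  walk (suc k) v with partner v
  ... | just (se j) = (j , up)   ∷ walk k (nw j)
  ... | just (nw j) = (j , down) ∷ walk k (se j)
  ... | just sw₁    = []
  ... | just neₔ    = []
  ... | nothing     = []

  -- The path crosses each of the d diagonals at most once.
  alternatingPath : List (Fin (suc n) × Direction)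
  alternatingPath = walk (suc n) sw₁

-- The direction in which the diagonal of a tile must be traversed in order to
-- be 𝓛-oriented, in terms of the parity of the number of the tile and of
-- b_T(𝓛_T, i_j).
𝓛-direction : ∀ {n} → (Fin (suc n) → Sign) → Fin (suc n) → Direction
𝓛-direction b j with parity (suc (toℕ j)) | b j
... | 1ℙ | Sign.+ = down
... | 1ℙ | Sign.- = up
... | 0ℙ | Sign.+ = up
... | 0ℙ | Sign.- = down

------------------------------------------------------------------------
-- Types of the matrices m_j

data MatrixType : Set where
  type₁ type₂ : MatrixType

-- m_1 is of first type iff H_1 is north-pointing, and for j > 1 the matrices
-- m_{j-1} and m_j have the same type iff H_{j-1} and H_j have different
-- shapes (iff the corresponding turns of the curve are the same).
-- Equivalently, in terms of the parity of j:
matrixType : ∀ {n} → (Fin n → Shape) → Fin n → MatrixType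
matrixType s j with parity (suc (toℕ j)) | s j
... | 1ℙ | north = type₁
... | 1ℙ | east  = type₂
... | 0ℙ | north = type₂
... | 0ℙ | east  = type₁

------------------------------------------------------------------------
-- Weights and matrices

-- The variables are arbitrary elements of an arbitrary commutative ring, the
-- x_{i_j} being invertible; indeterminates over ℤ are the universal case.
module Enumerator
  {c ℓ ℓ′} (R : CommutativeRing c ℓ) {Label : Set ℓ′} {n : ℕ}
  (B : OneSidedBand Label n) (b : Fin (suc n) → Sign)
  (x y : Label → CommutativeRing.Carrier R)
  (x-inv : ∀ j → Invertible (CommutativeRing._≈_ R) (CommutativeRing.1# R)
                   (CommutativeRing._*_ R) (x (OneSidedBand.diag B j)))
  where

  open CommutativeRing R using (Carrier; _+_; _*_; 0#; 1#)
  open OneSidedBand B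

  sum product : List Carrier → Carrier
  sum     = foldr _+_ 0#
  product = foldr _*_ 1#

  xᵢ yᵢ 1/xᵢ : Fin (suc n) → Carrier
  xᵢ j   = x (diag j)
  yᵢ j   = y (diag j)
  1/xᵢ j = proj₁ (x-inv j)

  xWeight : List (Edge n) → Carrier
  xWeight P = product (map (x ∘ label B) (descend P))

  yWeight : List (Edge n) → Carrier
  yWeight P = product (map yᵢ
    (filter (λ j → (j , 𝓛-direction b j) ∈ᴰ? alternatingPath shape P) (allFin (suc n))))

  goodMatchingEnumerator : Carrier
  goodMatchingEnumerator = sum (map (λ P → xWeight P * yWeight P) (goodMatchings shape))

  -- mat p q r s has rows (p , q) and (r , s).
  record Matrix : Set c where
    constructor mat
    field
      e₁₁ e₁₂ e₂₁ e₂₂ : Carrier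

  I₂ : Matrix
  I₂ = mat 1# 0#
           0# 1#

  infixl 7 _·_
  _·_ : Matrix → Matrix → Matrix
  mat p q r s · mat p′ q′ r′ s′ =
    mat (p * p′ + q * r′) (p * q′ + q * s′)
        (r * p′ + s * r′) (r * q′ + s * s′)

  tr : Matrix → Carrier
  tr (mat p _ _ s) = p + s

  mOf : MatrixType → Sign → Fin n → Matrix
  mOf t σ j = go t σ
    where
    xⱼ xⱼ₊₁ 1/xⱼ 1/xⱼ₊₁ xₐ yⱼ : Carrier
    xⱼ     = xᵢ (inject₁ j)
    xⱼ₊₁   = xᵢ (suc j)
    1/xⱼ   = 1/xᵢ (inject₁ j)
    1/xⱼ₊₁ = 1/xᵢ (suc j)
    xₐ     = x (arc j)
    yⱼ     = yᵢ (inject₁ j)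
    go : MatrixType → Sign → Matrix
    go type₁ Sign.+ = mat 1#                        0#
                          (xₐ * (1/xⱼ * 1/xⱼ₊₁))    yⱼ
    go type₂ Sign.+ = mat (xⱼ₊₁ * 1/xⱼ)  (xₐ * yⱼ)
                          0#             (xⱼ * yⱼ * 1/xⱼ₊₁)
    go type₁ Sign.- = mat yⱼ                             0#
                          (xₐ * yⱼ * (1/xⱼ * 1/xⱼ₊₁))    1#
    go type₂ Sign.- = mat (xⱼ₊₁ * yⱼ * 1/xⱼ)  xₐ
                          0#                  (xⱼ * 1/xⱼ₊₁)

  m : Fin n → Matrix
  m j = mOf (matrixType shape j) (b (inject₁ j)) j

  descendingProduct : ∀ {k} → (Fin k → Matrix) → Matrix
  descendingProduct {zero}  f = I₂
  descendingProduct {suc k} f = descendingProduct (f ∘ suc) · f zero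

  M : Matrix
  M = descendingProduct m

{-# OPTIONS --safe #-}

-- Every edge of the snake graph leads from the tile before to the tile after it,
-- and each tile contributes exactly two vertices, the ends of its diagonal.
-- Hence a perfect matching is a path: it has one edge for each pair of
-- consecutive tiles, and is determined by the ends at which it meets the
-- diagonals, that is, by the directions in which its alternating path crosses
-- them.  Such a sequence of directions is a matching iff consecutive directions
-- are joined by an edge, and the matching is good iff it contains a or a′.  So
-- the enumerator is a sum over sequences of directions of a product of local
-- weights, the trace of a product of 2 × 2 transfer matrices.  Swapping `up` and
-- `down` on the even tiles and splitting each x_{i_j} between the two
-- neighbouring factors turns these into the matrices m_j.

module Submission where

open import Defs
open import Algebra.Bundles using (CommutativeRing)
open import Algebra.Definitions using (Invertible)
import Algebra.Solver.Ring.NaturalCoefficients.Default as NatSolver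
open import Data.Bool using (Bool; true; false; if_then_else_)
open import Data.Fin using (Fin; zero; suc; inject₁; fromℕ; toℕ)
open import Data.Fin.Induction using (<-weakInduction)
open import Data.Fin.Properties
  using (all?; ¬∀⟶∃¬; fromℕ≢inject₁; inject₁-injective; toℕ-fromℕ; toℕ-inject₁)
import Data.Fin.Relation.Unary.Top as Top
open import Data.List
  using (List; []; _∷_; _++_; map; filter; foldr; length; head; mapMaybe; concatMap; allFin)
open import Data.List.Membership.Propositional using (_∈_; lose)
open import Data.List.Membership.Propositional.Properties
  using (∈-map⁺; ∈-map⁻; ∈-++⁺ˡ; ∈-++⁺ʳ; ∈-++⁻; ∈-filter⁺; ∈-filter⁻; ∈-allFin)
open import Data.List.Membership.Propositional.Properties.WithK using (unique∧set⇒bag)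
open import Data.List.Properties
  using (++-identityʳ; filter-++; filter-all; filter-none; filter-reject; map-cong; map-∘; map-tabulate)
open import Data.List.Relation.Binary.BagAndSetEquality using (∼bag⇒↭)
import Data.List.Relation.Binary.Permutation.Propositional as ↭
open ↭ using (_↭_; prep; swap)
open import Data.List.Relation.Binary.Sublist.Propositional
  using (_⊆_; []; _∷_; _∷ʳ_) renaming (lookup to ⊆-lookup)
open import Data.List.Relation.Binary.Sublist.Propositional.Properties using (++⁺; All-resp-⊆)
open import Data.List.Relation.Unary.All as All using ([]; _∷_)
import Data.List.Relation.Unary.All.Properties as All
open import Data.List.Relation.Unary.AllPairs using ([]; _∷_)
open import Data.List.Relation.Unary.Any using (here; there)
import Data.List.Relation.Unary.Any.Properties as Any
open import Data.List.Relation.Unary.Unique.Propositional using (Unique)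
import Data.List.Relation.Unary.Unique.Propositional.Properties as Unique
open import Data.Maybe using (Maybe; just; nothing)
open import Data.Nat using (ℕ; zero; suc; _∸_; parity)
open import Data.Nat.Properties using (1+n≢n)
open import Data.Parity using (Parity; 0ℙ; 1ℙ; _⁻¹)
open import Data.Parity.Properties using (suc-homo-⁻¹; ⁻¹-selfInverse)
open import Data.Product using (∃; _×_; _,_; proj₁; proj₂)
open import Data.Sign as Sign using (Sign)
open import Data.Sum as Sum using (_⊎_; inj₁; inj₂)
open import Data.Vec using (Vec; []; _∷_; lookup; tabulate)
open import Data.Vec.Properties using (lookup∘tabulate; tabulate∘lookup; tabulate-cong)
open import Function using (_∘_; id; mk⇔)
open import Relation.Binary.PropositionalEquality
  using (_≡_; _≢_; refl; sym; trans; cong; cong₂; subst)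
open import Relation.Nullary using (¬_; Dec; yes; no; does; ¬?; contradiction; _×-dec_; _⊎-dec_)
open import Relation.Nullary.Decidable using (dec-true; dec-false)
open import Relation.Unary using (Decidable; Pred)

-- Each parallelogram excludes one pair of equal directions: `down`, `down` if it is north-pointing,
-- `up`, `up` if it is east-pointing. Consecutive tiles have opposite parity, so the swap changes
-- exactly one member of each pair and moves the excluded pair off the diagonal. This is why the m_j
-- are triangular and why their type depends on shape and parity together. The same swap also
-- removes the parity of `d` from the position of `a′` and the parity of the tile from
-- 𝓛-orientation.
--
-- The weights have no denominators, whereas the m_j do. After the swap, x_{i_j} is given to the
-- transfer leaving tile j if its direction is `up` and to the one arriving there if it is `down`.
-- At the two ends of the snake one half has no transfer to go with. Up to the factor y_{i_d}, the
-- closing weights are x_a, x_{i_1}, x_{i_d} and 0; dividing them by these end halves gives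
-- x_a/x_{i_d}, x_{i_1}, 1/x_{i_1} and 0, the entries of the extra matrix in the trace.

-- Sublists

module _ {a} {A : Set a} where

  sublists-complete : {xs ys : List A} → xs ⊆ ys → xs ∈ sublists ys
  sublists-complete []           = here refl
  sublists-complete {ys = y ∷ ys} (_ ∷ʳ p) = ∈-++⁺ʳ (map (y ∷_) (sublists ys)) (sublists-complete p)
  sublists-complete {ys = y ∷ _} (refl ∷ p) = ∈-++⁺ˡ (∈-map⁺ (y ∷_) (sublists-complete p))

  sublists-sound : (ys : List A) {xs : List A} → xs ∈ sublists ys → xs ⊆ ys
  sublists-sound []       (here refl) = []
  sublists-sound (y ∷ ys) xs∈ with ∈-++⁻ (map (y ∷_) (sublists ys)) xs∈
  ... | inj₂ q = y ∷ʳ sublists-sound ys q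
  ... | inj₁ q with ∈-map⁻ (y ∷_) q
  ...   | _ , r , refl = refl ∷ sublists-sound ys r

  sublists-unique : {ys : List A} → Unique ys → Unique (sublists ys)
  sublists-unique []               = [] ∷ []
  sublists-unique {y ∷ ys} (y∉ ∷ u) =
    Unique.++⁺ (Unique.map⁺ (λ { refl → refl }) (sublists-unique u)) (sublists-unique u) disjoint
    where
    disjoint : ∀ {xs} → ¬ (xs ∈ map (y ∷_) (sublists ys) × xs ∈ sublists ys)
    disjoint (p , q) with ∈-map⁻ (y ∷_) p
    ... | _ , _ , refl = All.All¬⇒¬Any y∉ (⊆-lookup (sublists-sound ys q) (here refl))

  ⊆-unique : {xs ys : List A} → xs ⊆ ys → Unique ys → Unique xs
  ⊆-unique []         []       = []
  ⊆-unique (_ ∷ʳ p)   (_ ∷ u)  = ⊆-unique p u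
  ⊆-unique (refl ∷ p) (y∉ ∷ u) = All-resp-⊆ p y∉ ∷ ⊆-unique p u

  -- Both sublists inherit the order of a duplicate-free list, so membership leaves no freedom.
  -- Matchings, which are sets of edges, can thus be compared as lists.
  ⊆-extensional : {xs xs′ ys : List A} → Unique ys → xs ⊆ ys → xs′ ⊆ ys →
                  (∀ {e} → e ∈ xs → e ∈ xs′) → (∀ {e} → e ∈ xs′ → e ∈ xs) → xs ≡ xs′
  ⊆-extensional _        []         []         _ _ = refl
  ⊆-extensional (_ ∷ u)  (_ ∷ʳ p)   (_ ∷ʳ q)   f g = ⊆-extensional u p q f g
  ⊆-extensional (y∉ ∷ _) (_ ∷ʳ p)   (refl ∷ _) _ g =
    contradiction (⊆-lookup p (g (here refl))) (All.All¬⇒¬Any y∉)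
  ⊆-extensional (y∉ ∷ _) (refl ∷ _) (_ ∷ʳ q)   f _ =
    contradiction (⊆-lookup q (f (here refl))) (All.All¬⇒¬Any y∉)
  ⊆-extensional {ys = y ∷ _} (y∉ ∷ u) (refl ∷ p) (refl ∷ q) f g =
    cong (_ ∷_) (⊆-extensional u p q (weaken p f) (weaken q g))
    where
    weaken : ∀ {zs zs′} → zs ⊆ _ → (∀ {e} → e ∈ y ∷ zs → e ∈ y ∷ zs′) → ∀ {e} → e ∈ zs → e ∈ zs′
    weaken r h e∈ with h (there e∈)
    ... | there e∈′ = e∈′
    ... | here refl = contradiction (⊆-lookup r e∈) (All.All¬⇒¬Any y∉)

  module _ {p} {P : Pred A p} (P? : Decidable P) where

    -- Degree one in a form that hands out the matching edge. Uniqueness concerns values and not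
    -- positions, so only the passage back to a count asks for a list without repetitions.
    ExactlyOne : List A → Set _
    ExactlyOne xs = ∃ λ e → e ∈ xs × P e × (∀ {e′} → e′ ∈ xs → P e′ → e′ ≡ e)

    count≡1⇒exactlyOne : ∀ xs → length (filter P? xs) ≡ 1 → ExactlyOne xs
    count≡1⇒exactlyOne xs eq with filter P? xs in filtered
    ... | e ∷ [] = e , proj₁ e∈ , proj₂ e∈ , only
      where
      e∈ : e ∈ xs × P e
      e∈ = ∈-filter⁻ P? (subst (e ∈_) (sym filtered) (here refl))
      only : ∀ {e′} → e′ ∈ xs → P e′ → e′ ≡ e
      only e′∈ pe′ with subst (_ ∈_) filtered (∈-filter⁺ P? e′∈ pe′)
      ... | here e′≡e = e′≡e

    exactlyOne⇒count≡1 : ∀ {xs} → Unique xs → ExactlyOne xs → length (filter P? xs) ≡ 1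
    exactlyOne⇒count≡1 {x ∷ xs} (x∉ ∷ u) (e , e∈ , pe , only) with P? x | e∈
    ... | yes px | here refl =
      cong (λ ys → suc (length ys)) (filter-none P? (All.tabulate λ e′∈ pe′ →
        All.All¬⇒¬Any x∉ (subst (_∈ xs) (only (there e′∈) pe′) e′∈)))
    ... | yes px | there e∈′ =
      contradiction (subst (_∈ xs) (sym (only (here refl) px)) e∈′) (All.All¬⇒¬Any x∉)
    ... | no ¬px | here refl = contradiction pe ¬px
    ... | no ¬px | there e∈′ = exactlyOne⇒count≡1 u (e , e∈′ , pe , λ e′∈ → only (there e′∈))

  -- All successes of `f` agree, so it does not matter that `head` picks the earliest. It serves to
  -- compute `partner`.
  head-mapMaybe : ∀ {b} {B : Set b} (f : A → Maybe B) {w} xs →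
                  (∃ λ e → e ∈ xs × f e ≡ just w) →
                  (∀ {e w′} → e ∈ xs → f e ≡ just w′ → w′ ≡ w) →
                  head (mapMaybe f xs) ≡ just w
  head-mapMaybe f (x ∷ xs) (e , e∈ , fe) only with f x in fx
  ... | just w′ = cong just (only (here refl) fx)
  head-mapMaybe f (x ∷ xs) (e , here refl , fe) only | nothing with trans (sym fx) fe
  ... | ()
  head-mapMaybe f (x ∷ xs) (e , there e∈ , fe) only | nothing =
    head-mapMaybe f xs (e , e∈ , fe) (λ e∈ → only (there e∈))

-- Snake graphs as layered graphs

flip : Direction → Direction
flip up   = down
flip down = up

flip-irreflexive : ∀ δ → δ ≢ flip δ
flip-irreflexive up   ()
flip-irreflexive down ()

flip-injective : ∀ {δ δ′} → flip δ ≡ flip δ′ → δ ≡ δ′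
flip-injective {up}   {up}   _ = refl
flip-injective {down} {down} _ = refl

≢⇒≡flip : ∀ {δ δ′} → δ ≢ δ′ → δ ≡ flip δ′
≢⇒≡flip {up}   {up}   ne = contradiction refl ne
≢⇒≡flip {up}   {down} _  = refl
≢⇒≡flip {down} {up}   _  = refl
≢⇒≡flip {down} {down} ne = contradiction refl ne

-- The South edge of G_1 arrives at the SE corner, from which the diagonal goes up, and the North
-- edge of G_d departs from the NW corner, where an upward diagonal ends. One dictionary therefore
-- serves both ends of the snake.
axis : Direction → Axis
axis up   = horizontal
axis down = vertical

direction : Axis → Direction
direction horizontal = up
direction vertical   = down

axis-direction : ∀ α → axis (direction α) ≡ α
axis-direction horizontal = refl
axis-direction vertical   = refl

direction-axis : ∀ δ → direction (axis δ) ≡ δ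
direction-axis up   = refl
direction-axis down = refl

-- The corner at which the alternating path arrives at a tile whose diagonal it
-- then traverses in the given direction; it leaves from the flipped corner.
corner : ∀ {n} → Direction → Fin (suc n) → Vertex n
corner up   = se
corner down = nw

corner-injective : ∀ {n} δ δ′ {j k : Fin (suc n)} → corner δ j ≡ corner δ′ k → δ ≡ δ′ × j ≡ k
corner-injective up   up   refl = refl , refl
corner-injective down down refl = refl , refl

-- The directions at the two tiles of H_j of a matching that contains the given
-- side of H_j.
source target : Shape → Role → Direction
source north common = up
source north lower  = down
source north upper  = up
source east  common = down
source east  lower  = up
source east  upper  = down
target north common = up
target north lower  = up
target north upper  = down
target east  common = down
target east  lower  = down
target east  upper  = up

-- A junk value for the one pair of directions that no side of H_j joins.
role : Shape → Direction → Direction → Role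
role north up   up   = common
role north down _    = lower
role north up   down = upper
role east  down down = common
role east  up   _    = lower
role east  down up   = upper

-- The three sides of a parallelogram thus realise three different pairs of directions. The fourth
-- pair is `down`, `down` for `north` and `up`, `up` for `east`.
role-source-target : ∀ s r → role s (source s r) (target s r) ≡ r
role-source-target north common = refl
role-source-target north lower  = refl
role-source-target north upper  = refl
role-source-target east  common = refl
role-source-target east  lower  = refl
role-source-target east  upper  = refl

-- The round trip through `role` fails exactly where `role` returns its junk value.
Joined : Shape → Direction → Direction → Set
Joined s δ δ′ = source s (role s δ δ′) ≡ δ × target s (role s δ δ′) ≡ δ′

module _ {n : ℕ} where

  inner-⊆ : (r : Fin n → Role) (js : List (Fin n)) →
            map (λ j → inner j (r j)) js ⊆
            concatMap (λ j → inner j common ∷ inner j lower ∷ inner j upper ∷ []) js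
  inner-⊆ r []       = []
  inner-⊆ r (j ∷ js) = ++⁺ (single (r j)) (inner-⊆ r js)
    where
    single : ∀ t → inner j t ∷ [] ⊆ inner j common ∷ inner j lower ∷ inner j upper ∷ []
    single common = refl ∷ _ ∷ʳ _ ∷ʳ []
    single lower  = _ ∷ʳ refl ∷ _ ∷ʳ []
    single upper  = _ ∷ʳ _ ∷ʳ refl ∷ []

edges-unique : ∀ n → Unique (edges n)
edges-unique n =
  Unique.++⁺ {xs = first horizontal ∷ first vertical ∷ []} (((λ ()) ∷ []) ∷ [] ∷ [])
    (Unique.++⁺ (blocks-unique (Unique.allFin⁺ n)) (((λ ()) ∷ []) ∷ [] ∷ []) inner-last)
    first-rest
  where
  block : Fin n → List (Edge n)
  block j = inner j common ∷ inner j lower ∷ inner j upper ∷ []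
  in-block : ∀ js {e} → e ∈ concatMap block js → ∃ λ j → ∃ λ r → j ∈ js × e ≡ inner j r
  in-block (j ∷ js) (here refl)                 = j , _ , here refl , refl
  in-block (j ∷ js) (there (here refl))         = j , _ , here refl , refl
  in-block (j ∷ js) (there (there (here refl))) = j , _ , here refl , refl
  in-block (j ∷ js) (there (there (there e∈))) with in-block js e∈
  ... | k , r , k∈ , eq = k , r , there k∈ , eq
  blocks-unique : ∀ {js} → Unique js → Unique (concatMap block js)
  blocks-unique []                  = []
  blocks-unique {j ∷ js} (j∉ ∷ u) =
    Unique.++⁺ (((λ ()) ∷ (λ ()) ∷ []) ∷ ((λ ()) ∷ []) ∷ [] ∷ []) (blocks-unique u) disjoint
    where
    fresh : ∀ {r} → ¬ inner j r ∈ concatMap block js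
    fresh p with in-block js p
    ... | _ , _ , k∈ , refl = All.lookup j∉ k∈ refl
    disjoint : ∀ {e} → ¬ (e ∈ block j × e ∈ concatMap block js)
    disjoint (here refl , q)                 = fresh q
    disjoint (there (here refl) , q)         = fresh q
    disjoint (there (there (here refl)) , q) = fresh q
  ends′ : List (Edge n)
  ends′ = last horizontal ∷ last vertical ∷ []
  inner-last : ∀ {e} → ¬ (e ∈ concatMap block (allFin n) × e ∈ ends′)
  inner-last (p , q) with in-block (allFin n) p
  inner-last (p , there (there ())) | _ , _ , _ , refl
  first∉ : ∀ {α} → ¬ first α ∈ concatMap block (allFin n) ++ ends′
  first∉ p with ∈-++⁻ (concatMap block (allFin n)) p
  ... | inj₂ (there (there ()))
  ... | inj₁ q with in-block (allFin n) q
  ...   | _ , _ , _ , ()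
  first-rest : ∀ {e} → ¬ (e ∈ first horizontal ∷ first vertical ∷ []
                          × e ∈ concatMap block (allFin n) ++ ends′)
  first-rest (here refl , q)         = first∉ q
  first-rest (there (here refl) , q) = first∉ q

module _ {n : ℕ} (s : Fin n → Shape) where

  bottom top : Edge n → Vertex n
  bottom e = proj₁ (ends s e)
  top    e = proj₂ (ends s e)

  bottom-inner : ∀ j r → bottom (inner j r) ≡ corner (flip (source (s j) r)) (inject₁ j)
  bottom-inner j r with s j | r
  ... | north | common = refl
  ... | north | lower  = refl
  ... | north | upper  = refl
  ... | east  | common = refl
  ... | east  | lower  = refl
  ... | east  | upper  = refl

  top-inner : ∀ j r → top (inner j r) ≡ corner (target (s j) r) (suc j)
  top-inner j r with s j | r
  ... | north | common = refl
  ... | north | lower  = refl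
  ... | north | upper  = refl
  ... | east  | common = refl
  ... | east  | lower  = refl
  ... | east  | upper  = refl

  bottom-last : ∀ α → bottom (last α) ≡ corner (flip (direction α)) (fromℕ n)
  bottom-last horizontal = refl
  bottom-last vertical   = refl

  top-last : ∀ α → top (last α) ≡ neₔ
  top-last horizontal = refl
  top-last vertical   = refl

  bottom-first : ∀ α → bottom (first α) ≡ sw₁
  bottom-first horizontal = refl
  bottom-first vertical   = refl

  top-first : ∀ α → top (first α) ≡ corner (direction α) zero
  top-first horizontal = refl
  top-first vertical   = refl

-- Perfect matchings as paths

-- Records the tile on whose diagonal an edge ends and forgets which end of the diagonal it is, so
-- that uniqueness can be claimed for a whole tile instead of a vertex.
data Into {n} : Edge n → Fin (suc n) → Set where
  first : ∀ α   → Into (first α) zero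
  inner : ∀ j r → Into (inner j r) (suc j)

data OutOf {n} : Edge n → Fin (suc n) → Set where
  inner : ∀ j r → OutOf (inner j r) (inject₁ j)
  last  : ∀ α   → OutOf (last α) (fromℕ n)

Into⇒¬OutOf : ∀ {n} {e : Edge n} {k} → Into e k → ¬ OutOf e k
Into⇒¬OutOf {n} i o = clash i o refl
  where
  -- The two tiles are linked only by an equation, since `suc j` and `inject₁ j` do not unify.
  clash : ∀ {e : Edge n} {k l} → Into e k → OutOf e l → k ≢ l
  clash (inner j _) (inner j _) eq = 1+n≢n (trans (cong toℕ eq) (toℕ-inject₁ j))

module _ {n : ℕ} where

  JoinedAlong : (Fin n → Shape) → (Fin (suc n) → Direction) → Set
  JoinedAlong s σ = ∀ j → Joined (s j) (σ (inject₁ j)) (σ (suc j))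

  rung : (Fin n → Shape) → (Fin (suc n) → Direction) → Fin n → Edge n
  rung s σ j = inner j (role (s j) (σ (inject₁ j)) (σ (suc j)))

  path : (Fin n → Shape) → (Fin (suc n) → Direction) → List (Edge n)
  path s σ = first (axis (σ zero))
    ∷ map (rung s σ) (allFin n)
    ++ last (axis (σ (fromℕ n))) ∷ []

corner≢sw₁ : ∀ {n} δ {k : Fin (suc n)} → corner δ k ≢ sw₁
corner≢sw₁ up   ()
corner≢sw₁ down ()

corner≢neₔ : ∀ {n} δ {k : Fin (suc n)} → corner δ k ≢ neₔ
corner≢neₔ up   ()
corner≢neₔ down ()

module _ {n : ℕ} (s : Fin n → Shape) where

  into : ∀ e δ {k} → top s e ≡ corner δ k → Into e k
  into (first α) δ eq with corner-injective (direction α) δ (trans (sym (top-first s α)) eq)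
  ... | _ , refl = first α
  into (inner j r) δ eq with corner-injective (target (s j) r) δ (trans (sym (top-inner s j r)) eq)
  ... | _ , refl = inner j r
  into (last α) δ eq = contradiction (trans (sym eq) (top-last s α)) (corner≢neₔ δ)

  outOf : ∀ e δ {k} → bottom s e ≡ corner δ k → OutOf e k
  outOf (first α) δ eq = contradiction (trans (sym eq) (bottom-first s α)) (corner≢sw₁ δ)
  outOf (inner j r) δ eq
    with corner-injective (flip (source (s j) r)) δ (trans (sym (bottom-inner s j r)) eq)
  ... | _ , refl = inner j r
  outOf (last α) δ eq
    with corner-injective (flip (direction α)) δ (trans (sym (bottom-last s α)) eq)
  ... | _ , refl = last α

  top≢sw₁ : ∀ e → top s e ≢ sw₁
  top≢sw₁ (first α) eq   = corner≢sw₁ (direction α) (trans (sym (top-first s α)) eq)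
  top≢sw₁ (inner j r) eq = corner≢sw₁ (target (s j) r) (trans (sym (top-inner s j r)) eq)
  top≢sw₁ (last α) eq    with () ← trans (sym (top-last s α)) eq

  bottom≢neₔ : ∀ e → bottom s e ≢ neₔ
  bottom≢neₔ (first α) eq   with () ← trans (sym (bottom-first s α)) eq
  bottom≢neₔ (inner j r) eq = corner≢neₔ _ (trans (sym (bottom-inner s j r)) eq)
  bottom≢neₔ (last α) eq    = corner≢neₔ _ (trans (sym (bottom-last s α)) eq)

  first-of-sw₁ : ∀ e → bottom s e ≡ sw₁ → ∃ λ α → e ≡ first α
  first-of-sw₁ (first α) _    = α , refl
  first-of-sw₁ (inner j r) eq = contradiction (trans (sym (bottom-inner s j r)) eq) (corner≢sw₁ _)
  first-of-sw₁ (last α) eq    = contradiction (trans (sym (bottom-last s α)) eq) (corner≢sw₁ _)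

  last-of-neₔ : ∀ e → top s e ≡ neₔ → ∃ λ α → e ≡ last α
  last-of-neₔ (first α) eq   = contradiction (trans (sym (top-first s α)) eq) (corner≢neₔ _)
  last-of-neₔ (inner j r) eq = contradiction (trans (sym (top-inner s j r)) eq) (corner≢neₔ _)
  last-of-neₔ (last α) _     = α , refl

  module _ (σ : Fin (suc n) → Direction) where

    private
      firstₚ lastₚ : Edge n
      firstₚ = first (axis (σ zero))
      lastₚ  = last (axis (σ (fromℕ n)))

    first∈path : firstₚ ∈ path s σ
    first∈path = here refl

    inner∈path : ∀ j → rung s σ j ∈ path s σ
    inner∈path j = there (∈-++⁺ˡ (∈-map⁺ (rung s σ) (∈-allFin j)))

    last∈path : lastₚ ∈ path s σ
    last∈path = there (∈-++⁺ʳ (map (rung s σ) (allFin n)) (here refl))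

    data PathEdge : Edge n → Set where
      first : PathEdge firstₚ
      inner : ∀ j → PathEdge (rung s σ j)
      last  : PathEdge lastₚ

    ∈path⇒PathEdge : ∀ {e} → e ∈ path s σ → PathEdge e
    ∈path⇒PathEdge (here refl) = first
    ∈path⇒PathEdge (there e∈) with ∈-++⁻ (map (rung s σ) (allFin n)) e∈
    ... | inj₂ (here refl) = last
    ... | inj₁ q with ∈-map⁻ (rung s σ) q
    ...   | j , _ , refl = inner j

    path-⊆-edges : path s σ ⊆ edges n
    path-⊆-edges = ++⁺ (firsts (axis (σ zero)))
      (++⁺ (inner-⊆ (λ j → role (s j) (σ (inject₁ j)) (σ (suc j))) (allFin n))
           (lasts (axis (σ (fromℕ n)))))
      where
      firsts : ∀ α → first α ∷ [] ⊆ first horizontal ∷ first vertical ∷ []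
      firsts horizontal = refl ∷ _ ∷ʳ []
      firsts vertical   = _ ∷ʳ refl ∷ []
      lasts : ∀ α → last α ∷ [] ⊆ last horizontal ∷ last vertical ∷ []
      lasts horizontal = refl ∷ _ ∷ʳ []
      lasts vertical   = _ ∷ʳ refl ∷ []

    module _ (joined : JoinedAlong s σ) where

      arrival : ∀ k → ∃ λ e → e ∈ path s σ × top s e ≡ corner (σ k) k
      arrival zero    = _ , first∈path ,
        trans (top-first s _) (cong (λ δ → corner δ zero) (direction-axis _))
      arrival (suc j) = _ , inner∈path j ,
        trans (top-inner s j _) (cong (λ δ → corner δ (suc j)) (proj₂ (joined j)))

      departure : ∀ k → ∃ λ e → e ∈ path s σ × bottom s e ≡ corner (flip (σ k)) k
      departure k with Top.view k
      ... | Top.‵fromℕ     = _ , last∈path ,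
        trans (bottom-last s _) (cong (λ δ → corner (flip δ) (fromℕ n)) (direction-axis _))
      ... | Top.‵inject₁ j = _ , inner∈path j ,
        trans (bottom-inner s j _) (cong (λ δ → corner (flip δ) (inject₁ j)) (proj₁ (joined j)))

      into-unique : ∀ {e e′ k} → e ∈ path s σ → e′ ∈ path s σ → Into e k → Into e′ k → e ≡ e′
      into-unique e∈ e′∈ (first _)   (first _)   with ∈path⇒PathEdge e∈ | ∈path⇒PathEdge e′∈
      ... | first | first = refl
      into-unique e∈ e′∈ (inner j _) (inner j _) with ∈path⇒PathEdge e∈ | ∈path⇒PathEdge e′∈
      ... | inner _ | inner _ = refl

      outOf-unique : ∀ {e e′ k} → e ∈ path s σ → e′ ∈ path s σ → OutOf e k → OutOf e′ k → e ≡ e′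
      outOf-unique {e} {e′} e∈ e′∈ o o′ = same (∈path⇒PathEdge e∈) (∈path⇒PathEdge e′∈) o o′ refl
        where
        same : ∀ {e e′ k l} → PathEdge e → PathEdge e′ → OutOf e k → OutOf e′ l → k ≡ l → e ≡ e′
        same (inner j) (inner l) (inner j _) (inner l _) eq with inject₁-injective eq
        ... | refl = refl
        same (inner j) last (inner j _) (last _) eq = contradiction (sym eq) fromℕ≢inject₁
        same last (inner l) (last _) (inner l _) eq = contradiction eq fromℕ≢inject₁
        same last last (last _) (last _) _ = refl

      -- Only one edge of the path enters the tile, and `arrival` knows at which corner.
      arrives-by : ∀ {e k} δ → e ∈ path s σ → top s e ≡ corner δ k → δ ≡ σ k
      arrives-by {e} {k} δ e∈ eq with arrival k
      ... | e′ , e′∈ , eq′ with into-unique e∈ e′∈ (into e δ eq) (into e′ _ eq′)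
      ...   | refl = proj₁ (corner-injective δ (σ k) (trans (sym eq) eq′))

      leaves-by : ∀ {e k} δ → e ∈ path s σ → bottom s e ≡ corner δ k → δ ≡ flip (σ k)
      leaves-by {e} {k} δ e∈ eq with departure k
      ... | e′ , e′∈ , eq′ with outOf-unique e∈ e′∈ (outOf e δ eq) (outOf e′ _ eq′)
      ...   | refl = proj₁ (corner-injective δ (flip (σ k)) (trans (sym eq) eq′))

      -- Of the two ends of a diagonal, one is met by the edge entering the tile and the other by
      -- the edge leaving it; which is which depends on whether `δ` is `σ k`.
      corner-exactlyOne : ∀ δ k → ExactlyOne (incident? s (corner δ k)) (path s σ)
      corner-exactlyOne δ k with δ ≟ᴰ σ k
      ... | yes refl with arrival k
      ...   | e , e∈ , eq = e , e∈ , inj₂ (sym eq) , λ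
        { e′∈ (inj₁ eq′) → contradiction (leaves-by δ e′∈ (sym eq′)) (flip-irreflexive δ)
        ; e′∈ (inj₂ eq′) → into-unique e′∈ e∈ (into _ δ (sym eq′)) (into e δ eq) }
      corner-exactlyOne δ k | no δ≢ with ≢⇒≡flip δ≢ | departure k
      ...   | refl | e , e∈ , eq = e , e∈ , inj₁ (sym eq) , λ
        { e′∈ (inj₁ eq′) → outOf-unique e′∈ e∈ (outOf _ δ (sym eq′)) (outOf e δ eq)
        ; e′∈ (inj₂ eq′) → contradiction (arrives-by δ e′∈ (sym eq′)) δ≢ }

      path-exactlyOne : ∀ v → ExactlyOne (incident? s v) (path s σ)
      path-exactlyOne sw₁ = _ , first∈path , inj₁ (sym (bottom-first s (axis (σ zero)))) , only
        where
        only : ∀ {e} → e ∈ path s σ → Incident s sw₁ e → e ≡ firstₚ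
        only {e} _  (inj₂ eq) = contradiction (sym eq) (top≢sw₁ e)
        only {e} e∈ (inj₁ eq) with first-of-sw₁ e (sym eq)
        ... | _ , refl with ∈path⇒PathEdge e∈
        ...   | first = refl
      path-exactlyOne neₔ = _ , last∈path , inj₂ (sym (top-last s (axis (σ (fromℕ n))))) , only
        where
        only : ∀ {e} → e ∈ path s σ → Incident s neₔ e → e ≡ lastₚ
        only {e} _  (inj₁ eq) = contradiction (sym eq) (bottom≢neₔ e)
        only {e} e∈ (inj₂ eq) with last-of-neₔ e (sym eq)
        ... | _ , refl with ∈path⇒PathEdge e∈
        ...   | last = refl
      path-exactlyOne (nw k) = corner-exactlyOne down k
      path-exactlyOne (se k) = corner-exactlyOne up k

      path-perfect : Perfect s (path s σ)
      path-perfect v =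
        exactlyOne⇒count≡1 (incident? s v) (⊆-unique path-⊆-edges (edges-unique n)) (path-exactlyOne v)

  -- From a perfect matching to its sequence of directions

  module _ {P : List (Edge n)} (exact : ∀ v → ExactlyOne (incident? s v) P) where

    -- The last component excludes edges entering at the opposite corner as well. Exactness at one
    -- vertex does not give this; it is the invariant carried from tile to tile.
    Arrival : Fin (suc n) → Direction → Edge n → Set
    Arrival k δ e = e ∈ P × top s e ≡ corner δ k × (∀ {e′} → e′ ∈ P → Into e′ k → e′ ≡ e)

    Departure : Fin (suc n) → Direction → Edge n → Set
    Departure k δ e = e ∈ P × bottom s e ≡ corner (flip δ) k × (∀ {e′} → e′ ∈ P → OutOf e′ k → e′ ≡ e)

    outOf-corner : ∀ {e k} → OutOf e k → ∃ λ δ → bottom s e ≡ corner δ k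
    outOf-corner (inner j r) = _ , bottom-inner s j r
    outOf-corner (last α)    = _ , bottom-last s α

    -- The opposite end of the diagonal is matched too. An edge entering there would have to be `e`,
    -- which ends at the other corner, so the matching edge leaves. A second leaving edge would
    -- start either at that same vertex or at the vertex already matched by `e`.
    arrival⇒departure : ∀ {k δ e} → Arrival k δ e → ∃ (Departure k δ)
    arrival⇒departure {k} {δ} {e} (e∈ , e-top , e-only) with exact (corner (flip δ) k)
    ... | f , f∈ , inj₂ f-top , _ with e-only f∈ (into f (flip δ) (sym f-top))
    ...   | refl = contradiction (proj₁ (corner-injective δ (flip δ) (trans (sym e-top) (sym f-top))))
                                 (flip-irreflexive δ)
    arrival⇒departure {k} {δ} {e} (e∈ , e-top , e-only) | f , f∈ , inj₁ f-bottom , f-only =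
      f , f∈ , sym f-bottom , only
      where
      only : ∀ {g} → g ∈ P → OutOf g k → g ≡ f
      only {g} g∈ o with outOf-corner o
      ... | δ′ , g-bottom with δ′ ≟ᴰ δ
      ...   | no δ′≢δ with ≢⇒≡flip δ′≢δ
      ...     | refl = f-only g∈ (inj₁ (sym g-bottom))
      only {g} g∈ o | δ , g-bottom | yes refl with exact (corner δ k)
      ... | _ , _ , _ , only′
        with trans (only′ e∈ (inj₂ (sym e-top))) (sym (only′ g∈ (inj₁ (sym g-bottom))))
      ...   | refl = contradiction o (Into⇒¬OutOf (into e δ e-top))

    departure⇒inner : ∀ {j δ e} → Departure (inject₁ j) δ e →
                      ∃ λ r → e ≡ inner j r × source (s j) r ≡ δ
    departure⇒inner {j} {δ} {e} (_ , eq , _) = go (outOf e (flip δ) eq) refl eq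
      where
      go : ∀ {e k} → OutOf e k → k ≡ inject₁ j → bottom s e ≡ corner (flip δ) k →
           ∃ λ r → e ≡ inner j r × source (s j) r ≡ δ
      go (last α)    eq _ = contradiction eq fromℕ≢inject₁
      go (inner i r) eq b with inject₁-injective eq
      ... | refl = r , refl , flip-injective (proj₁ (corner-injective (flip (source (s i) r)) (flip δ)
                     (trans (sym (bottom-inner s i r)) b)))

    departure⇒arrival : ∀ {j δ r} → Departure (inject₁ j) δ (inner j r) →
                        Arrival (suc j) (target (s j) r) (inner j r)
    departure⇒arrival {j} {r = r} (e∈ , _ , only) =
      e∈ , top-inner s j r , λ { f∈ (inner j r′) → only f∈ (inner j r′) }

    -- Exactly one edge of P enters each tile.  If this holds for a tile, the edge
    -- at the other end of its diagonal must leave the tile, and nothing else can.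
    arrivals : ∀ k → ∃ λ δ → ∃ (Arrival k δ)
    arrivals = <-weakInduction _ start step
      where
      start : ∃ λ δ → ∃ (Arrival zero δ)
      start with exact sw₁
      ... | e , _  , inj₂ eq , _ = contradiction (sym eq) (top≢sw₁ e)
      ... | e , e∈ , inj₁ eq , only with first-of-sw₁ e (sym eq)
      ...   | α , refl = direction α , first α , e∈ , top-first s α ,
                         λ { f∈ (first β) → only f∈ (inj₁ (sym (bottom-first s β))) }
      step : ∀ j → (∃ λ δ → ∃ (Arrival (inject₁ j) δ)) → ∃ λ δ → ∃ (Arrival (suc j) δ)
      step j (_ , _ , a) with arrival⇒departure a
      ... | _ , d with departure⇒inner d
      ...   | _ , refl , _ = _ , _ , departure⇒arrival d

    module _ {σ : Fin (suc n) → Direction} (arrive : ∀ k → ∃ (Arrival k (σ k))) where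

      -- The edge leaving one tile enters the next, where only one edge of `P` enters. So the edges
      -- found from the two neighbouring tiles coincide, and a single side of H_j realises both
      -- directions.
      rungs : ∀ j → ∃ λ r → inner j r ∈ P
                × source (s j) r ≡ σ (inject₁ j) × target (s j) r ≡ σ (suc j)
                × (∀ {r′} → inner j r′ ∈ P → inner j r′ ≡ inner j r)
      rungs j with arrive (inject₁ j) | arrive (suc j)
      ... | _ , a | e , e∈ , e-top , only with arrival⇒departure a
      ...   | f , d with departure⇒inner d
      ...     | r , refl , src with only (proj₁ d) (inner j r)
      ...       | refl = r , e∈ , src
                       , proj₁ (corner-injective (target (s j) r) (σ (suc j))
                           (trans (sym (top-inner s j r)) e-top))
                       , λ f∈ → only f∈ (inner j _)

      σ-joined : JoinedAlong s σ
      σ-joined j with rungs j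
      ... | r , _ , src , tgt , _ rewrite sym src | sym tgt | role-source-target (s j) r = refl , refl

      rung≡role : ∀ j → proj₁ (rungs j) ≡ role (s j) (σ (inject₁ j)) (σ (suc j))
      rung≡role j with rungs j
      ... | r , _ , src , tgt , _ rewrite sym src | sym tgt = sym (role-source-target (s j) r)

      perfect⇒path : P ⊆ edges n → P ≡ path s σ
      perfect⇒path P⊆ = ⊆-extensional (edges-unique n) P⊆ (path-⊆-edges σ)
                          (λ {e} → to e) (λ e∈ → from (∈path⇒PathEdge σ e∈))
        where
        first-axis : ∃ λ α → first α ∈ P × α ≡ axis (σ zero)
                       × (∀ {β} → first β ∈ P → _≡_ {A = Edge n} (first β) (first α))
        first-axis with arrive zero
        ... | e , e∈ , eq , only with into e (σ zero) eq
        ...   | first α = α , e∈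
                        , trans (sym (axis-direction α)) (cong axis (proj₁
                            (corner-injective (direction α) (σ zero) (trans (sym (top-first s α)) eq))))
                        , λ f∈ → only f∈ (first _)
        last-axis : ∃ λ α → last α ∈ P × α ≡ axis (σ (fromℕ n))
                      × (∀ {β} → last β ∈ P → _≡_ {A = Edge n} (last β) (last α))
        last-axis = go (proj₂ (arrival⇒departure (proj₂ (arrive (fromℕ n)))))
          where
          go : ∀ {δ e} → Departure (fromℕ n) δ e →
               ∃ λ α → last α ∈ P × α ≡ axis δ
                 × (∀ {β} → last β ∈ P → _≡_ {A = Edge n} (last β) (last α))
          go {δ} {e} (e∈ , eq , only) = by-case (outOf e (flip δ) eq) refl e∈ eq only
            where
            by-case : ∀ {e k} → OutOf e k → k ≡ fromℕ n → e ∈ P → bottom s e ≡ corner (flip δ) k →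
                      (∀ {f} → f ∈ P → OutOf f (fromℕ n) → f ≡ e) →
                      ∃ λ α → last α ∈ P × α ≡ axis δ
                        × (∀ {β} → last β ∈ P → _≡_ {A = Edge n} (last β) (last α))
            by-case (inner j r) eq _ _ _ = contradiction (sym eq) fromℕ≢inject₁
            by-case (last α) _ e∈ b only = α , e∈ ,
              trans (sym (axis-direction α)) (cong axis (flip-injective
                (proj₁ (corner-injective _ (flip δ) (trans (sym (bottom-last s α)) b))))) ,
              λ f∈ → only f∈ (last _)
        to : ∀ e → e ∈ P → e ∈ path s σ
        to (first α) e∈ with first-axis
        ... | _ , _ , eq , only =
          subst (_∈ path s σ) (sym (trans (only e∈) (cong Edge.first eq))) (first∈path σ)
        to (inner j r) e∈ = subst (_∈ path s σ)
          (sym (trans (proj₂ (proj₂ (proj₂ (proj₂ (rungs j)))) e∈) (cong (inner j) (rung≡role j))))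
          (inner∈path σ j)
        to (last α) e∈ with last-axis
        ... | _ , _ , eq , only =
          subst (_∈ path s σ) (sym (trans (only e∈) (cong Edge.last eq))) (last∈path σ)
        from : ∀ {e} → PathEdge σ e → e ∈ P
        from first with first-axis
        ... | _ , e∈ , eq , _ = subst (λ α → first α ∈ P) eq e∈
        from (inner j) = subst (λ r → inner j r ∈ P) (rung≡role j) (proj₁ (proj₂ (rungs j)))
        from last with last-axis
        ... | _ , e∈ , eq , _ = subst (λ α → last α ∈ P) eq e∈

module _ {n : ℕ} (s : Fin n → Shape) where

  perfect⇒∃path : ∀ {P} → Perfect s P → P ⊆ edges n → ∃ λ σ → JoinedAlong s σ × P ≡ path s σ
  perfect⇒∃path {P} perfect P⊆ =
    (λ k → proj₁ (arrivals s exact k)) , σ-joined s exact arrive , perfect⇒path s exact arrive P⊆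
    where
    exact : ∀ v → ExactlyOne (incident? s v) P
    exact v = count≡1⇒exactlyOne (incident? s v) P (perfect v)
    arrive : ∀ k → ∃ (Arrival s exact k (proj₁ (arrivals s exact k)))
    arrive k = proj₂ (arrivals s exact k)

  -- The alternating path of a path

  otherEnd-bottom : ∀ P v e → v ≡ bottom s e → otherEnd s P v e ≡ just (top s e)
  otherEnd-bottom P v e eq with v ≟ⱽ bottom s e | v ≟ⱽ top s e
  ... | yes _ | _ = refl
  ... | no ne | _ = contradiction eq ne

  otherEnd-incident : ∀ P v {w} e → otherEnd s P v e ≡ just w → Incident s v e
  otherEnd-incident P v e eq with v ≟ⱽ bottom s e | v ≟ⱽ top s e
  ... | yes p | _     = inj₁ p
  ... | no _  | yes q = inj₂ q

  partner-bottom : ∀ {P} v e → ExactlyOne (incident? s v) P → e ∈ P → v ≡ bottom s e →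
                   partner s P v ≡ just (top s e)
  partner-bottom {P} v e (_ , _ , _ , only) e∈ eq =
    head-mapMaybe (otherEnd s P v) P (e , e∈ , otherEnd-bottom P v e eq) unique
    where
    unique : ∀ {f w} → f ∈ P → otherEnd s P v f ≡ just w → w ≡ top s e
    unique {f} f∈ f-eq
      with trans (only f∈ (otherEnd-incident P v f f-eq)) (sym (only e∈ (inj₁ eq)))
    ... | refl with trans (sym f-eq) (otherEnd-bottom P v e eq)
    ...   | refl = refl

  walk-corner : ∀ P v {j} δ m → partner s P v ≡ just (corner δ j) →
                walk s P (suc m) v ≡ (j , δ) ∷ walk s P m (corner (flip δ) j)
  walk-corner P v up   m eq rewrite eq = refl
  walk-corner P v down m eq rewrite eq = refl

  walk-end : ∀ P v m → partner s P v ≡ just neₔ → walk s P m v ≡ []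
  walk-end P v zero    eq = refl
  walk-end P v (suc m) eq rewrite eq = refl

  module _ {σ : Fin (suc n) → Direction} (joined : JoinedAlong s σ) where

    private
      P = path s σ

    walk-start : ∀ m → walk s P (suc m) sw₁ ≡ (zero , σ zero) ∷ walk s P m (corner (flip (σ zero)) zero)
    walk-start m = walk-corner P sw₁ (σ zero) m
      (trans (partner-bottom sw₁ (first (axis (σ zero))) (path-exactlyOne s σ joined sw₁) (first∈path s σ)
                             (sym (bottom-first s (axis (σ zero)))))
             (cong just (trans (top-first s (axis (σ zero)))
                               (cong (λ δ → corner δ zero) (direction-axis (σ zero))))))

    walk-step : ∀ m j → walk s P (suc m) (corner (flip (σ (inject₁ j))) (inject₁ j)) ≡
                        (suc j , σ (suc j)) ∷ walk s P m (corner (flip (σ (suc j))) (suc j))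
    walk-step m j = walk-corner P exit (σ (suc j)) m
      (trans (partner-bottom exit (rung s σ j) (path-exactlyOne s σ joined exit) (inner∈path s σ j)
               (sym (trans (bottom-inner s j _)
                           (cong (λ δ → corner (flip δ) (inject₁ j)) (proj₁ (joined j))))))
             (cong just (trans (top-inner s j _)
                               (cong (λ δ → corner δ (suc j)) (proj₂ (joined j))))))
      where
      exit : Vertex n
      exit = corner (flip (σ (inject₁ j))) (inject₁ j)

    walk-stop : ∀ m → walk s P m (corner (flip (σ (fromℕ n))) (fromℕ n)) ≡ []
    walk-stop m = walk-end P exit m
      (trans (partner-bottom exit (last (axis (σ (fromℕ n)))) (path-exactlyOne s σ joined exit) (last∈path s σ)
               (sym (trans (bottom-last s _)
                           (cong (λ δ → corner (flip δ) (fromℕ n)) (direction-axis (σ (fromℕ n)))))))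
             (cong just (top-last s (axis (σ (fromℕ n))))))
      where
      exit : Vertex n
      exit = corner (flip (σ (fromℕ n))) (fromℕ n)

    walk-sound : ∀ m k {x} → x ∈ walk s P m (corner (flip (σ k)) k) → proj₂ x ≡ σ (proj₁ x)
    walk-sound m k x∈ with Top.view k
    ... | Top.‵fromℕ with () ← subst (_ ∈_) (walk-stop m) x∈
    walk-sound (suc m) k x∈ | Top.‵inject₁ j with subst (_ ∈_) (walk-step m j) x∈
    ... | here refl = refl
    ... | there x∈′ = walk-sound m (suc j) x∈′

    alternatingPath-sound : ∀ {k δ} → (k , δ) ∈ alternatingPath s P → δ ≡ σ k
    alternatingPath-sound x∈ with subst (_ ∈_) (walk-start n) x∈
    ... | here refl = refl
    ... | there x∈′ = walk-sound n zero x∈′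

    alternatingPath-complete : ∀ k → (k , σ k) ∈ alternatingPath s P
    alternatingPath-complete k = proj₁ (reached k)
      where
      -- `n ∸ toℕ k` is what is left of the bound `suc n` once the diagonal of tile `k` is recorded:
      -- one unit for each later tile. The second component says that the remaining walk is part of
      -- the whole.
      Reached : Fin (suc n) → Set
      Reached k = (k , σ k) ∈ alternatingPath s P
        × (∀ {x} → x ∈ walk s P (n ∸ toℕ k) (corner (flip (σ k)) k) → x ∈ alternatingPath s P)
      fuel : ∀ {n} (j : Fin n) → n ∸ toℕ (inject₁ j) ≡ suc (n ∸ toℕ (suc j))
      fuel zero    = refl
      fuel (suc j) = fuel j
      step : ∀ j → Reached (inject₁ j) → Reached (suc j)
      step j (_ , incl) rewrite fuel j | walk-step (n ∸ toℕ (suc j)) j =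
        incl (here refl) , λ x∈ → incl (there x∈)
      reached : ∀ k → Reached k
      reached = <-weakInduction Reached
        (subst ((zero , σ zero) ∈_) (sym (walk-start n)) (here refl)
        , λ x∈ → subst (_ ∈_) (sym (walk-start n)) (there x∈))
        step

  -- The alternating path of a matching records its directions, so these can be read off the list of
  -- edges.
  path-injective : ∀ {σ τ} → JoinedAlong s σ → JoinedAlong s τ → path s σ ≡ path s τ → ∀ k → σ k ≡ τ k
  path-injective {σ} jσ jτ eq k = alternatingPath-sound jτ
    (subst (λ P → (k , σ k) ∈ alternatingPath s P) eq (alternatingPath-complete jσ k))

-- Good matchings

module _ {n : ℕ} where

  descend-a′ : {P : List (Edge n)} → a′ ∈ P → descend P ≡ P ∖ a′
  descend-a′ {P} a′∈ with a′ ∈ᴱ? P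
  ... | yes _   = refl
  ... | no a′∉ = contradiction a′∈ a′∉

  descend-a₁ : {P : List (Edge n)} → ¬ a′ ∈ P → descend P ≡ P ∖ a₁
  descend-a₁ {P} a′∉ with a′ ∈ᴱ? P
  ... | yes a′∈ = contradiction a′∈ a′∉
  ... | no _    = refl

  module _ (s : Fin n → Shape) (σ : Fin (suc n) → Direction) where

    -- Whether `a`, respectively `a′`, is used, expressed by directions. The second condition goes
    -- through the axis because `a′` is the North or the East edge according to the parity of `d`.
    CutsFirst CutsLast : Set
    CutsFirst = σ zero ≡ up
    CutsLast  = axis (σ (fromℕ n)) ≡ cutAxis (suc n)

    a₁∈path⇒cutsFirst : a₁ ∈ path s σ → CutsFirst
    a₁∈path⇒cutsFirst p = go (∈path⇒PathEdge s σ p) refl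
      where
      first-injective : ∀ {α β} → _≡_ {A = Edge n} (first α) (first β) → α ≡ β
      first-injective refl = refl
      go : ∀ {e} → PathEdge s σ e → e ≡ a₁ → CutsFirst
      go first eq = trans (sym (direction-axis (σ zero))) (cong direction (first-injective eq))

    a′∈path⇒cutsLast : a′ ∈ path s σ → CutsLast
    a′∈path⇒cutsLast p = go (∈path⇒PathEdge s σ p) refl
      where
      go : ∀ {e} → PathEdge s σ e → e ≡ a′ → CutsLast
      go last eq = last-injective eq
        where
        last-injective : ∀ {α β} → _≡_ {A = Edge n} (last α) (last β) → α ≡ β
        last-injective refl = refl

    cutsFirst⇒a₁∈path : CutsFirst → a₁ ∈ path s σ
    cutsFirst⇒a₁∈path eq = here (cong (λ δ → Edge.first (axis δ)) (sym eq))

    cutsLast⇒a′∈path : CutsLast → a′ ∈ path s σ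
    cutsLast⇒a′∈path eq = subst (λ α → Edge.last α ∈ path s σ) eq (last∈path s σ)

    inners-∖ : ∀ {e} → (∀ {j r} → _≢_ {A = Edge n} (inner j r) e) → ∀ es →
               (map (rung s σ) (allFin n) ++ es) ∖ e ≡ map (rung s σ) (allFin n) ++ es ∖ e
    inners-∖ {e} ne es = trans (filter-++ (λ f → ¬? (f ≟ᴱ e)) (map (rung s σ) (allFin n)) es)
      (cong (_++ es ∖ e)
        (filter-all (λ f → ¬? (f ≟ᴱ e)) (All.map⁺ (All.universal (λ _ → ne) (allFin n)))))

    descend-cutsLast : CutsLast → descend (path s σ) ≡ first (axis (σ zero)) ∷ map (rung s σ) (allFin n)
    descend-cutsLast cl = trans (descend-a′ (cutsLast⇒a′∈path cl)) (cong (first (axis (σ zero)) ∷_)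
      (trans (inners-∖ (λ ()) _) (trans
        (cong (map (rung s σ) (allFin n) ++_)
          (filter-reject (λ f → ¬? (f ≟ᴱ a′)) (λ ne → ne (cong Edge.last cl))))
        (++-identityʳ _))))

    descend-cutsFirst : CutsFirst → ¬ CutsLast →
                        descend (path s σ) ≡ map (rung s σ) (allFin n) ++ last (axis (σ (fromℕ n))) ∷ []
    descend-cutsFirst cf ¬cl = trans (descend-a₁ (¬cl ∘ a′∈path⇒cutsLast))
      (trans (filter-reject (λ f → ¬? (f ≟ᴱ a₁)) (λ ne → ne (cong (λ δ → Edge.first (axis δ)) cf)))
             (inners-∖ (λ ()) _))

    cutsFirst? : Dec CutsFirst
    cutsFirst? = σ zero ≟ᴰ up

    cutsLast? : Dec CutsLast
    cutsLast? = axis (σ (fromℕ n)) ≟ᴬ cutAxis (suc n)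

module _ {n : ℕ} (s : Fin n → Shape) (σ : Fin (suc n) → Direction) (joined : JoinedAlong s σ) where

  inner-bottom : ∀ j → Incident s (corner (flip (σ (inject₁ j))) (inject₁ j)) (rung s σ j)
  inner-bottom j = inj₁ (sym (trans (bottom-inner s j _)
                                    (cong (λ δ → corner (flip δ) (inject₁ j)) (proj₁ (joined j)))))

  inner-top : ∀ j → Incident s (corner (σ (suc j)) (suc j)) (rung s σ j)
  inner-top j = inj₂ (sym (trans (top-inner s j _)
                                 (cong (λ δ → corner δ (suc j)) (proj₂ (joined j)))))

  covered : ∀ v j → Incident s v (rung s σ j) → Covers s (map (rung s σ) (allFin n)) v
  covered v j = lose {P = Incident s v} (∈-map⁺ (rung s σ) (∈-allFin j))

  a₁∉inners : ¬ a₁ ∈ map (rung s σ) (allFin n)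
  a₁∉inners p with () ← proj₂ (proj₂ (∈-map⁻ (rung s σ) p))

-- Removing `a′` leaves every edge on the side of G_1 in place. Either `a` remains, or the West edge
-- covers `x₁` and `y₁` is the corner from which the path leaves G_1, covered by a side of H_1.
sameSide-cutsLast : ∀ {n} (s : Fin n → Shape) σ → JoinedAlong s σ → CutsLast s σ →
                    SameSide s (descend (path s σ))
sameSide-cutsLast {n} s σ joined cl rewrite descend-cutsLast s σ cl with σ zero in σ₀
... | up   = matched (here refl)
... | down = onFirst a₁∉ (here (inj₁ refl)) (there (covers-y₁ s σ joined cl σ₀))
  where
  a₁∉ : ¬ a₁ ∈ first vertical ∷ _
  a₁∉ (there p) = a₁∉inners s σ joined p
  covers-y₁ : ∀ {n} (s : Fin n → Shape) σ → JoinedAlong s σ → CutsLast s σ → σ zero ≡ down →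
              Covers s (map (rung s σ) (allFin n)) (se zero)
  -- With a single tile there is no H_1, but then `a′` is the North edge and using it forces `up`.
  covers-y₁ {zero}  s σ joined cl eq with () ← trans (sym cl) (cong axis eq)
  covers-y₁ {suc n} s σ joined cl eq = covered s σ joined (se zero) zero
    (subst (λ δ → Incident s (corner (flip δ) zero) (rung s σ zero)) eq (inner-bottom s σ joined zero))

-- The mirror case: the other edge at the NE corner of G_d covers `yₔ`. As the path leaves G_d from
-- the corner not on `a′`, it arrives at `xₔ`, which the last rung covers. With a single tile, using
-- `a` forces using `a′`.
sameSide-cutsFirst : ∀ {n} (s : Fin n → Shape) σ → JoinedAlong s σ → CutsFirst s σ → ¬ CutsLast s σ →
                     SameSide s (descend (path s σ))
sameSide-cutsFirst {n} s σ joined cf ¬cl rewrite descend-cutsFirst s σ cf ¬cl =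
  onLast a₁∉ (Any.++⁺ˡ (covers-xₔ s σ joined cf ¬cl))
             (Any.++⁺ʳ (map (rung s σ) (allFin n)) (here (inj₂ (sym (top-last s (axis (σ (fromℕ n))))))))
  where
  a₁∉ : ¬ a₁ ∈ _ ++ last _ ∷ []
  a₁∉ p with ∈-++⁻ (map (rung s σ) (allFin n)) p
  ... | inj₁ q = a₁∉inners s σ joined q
  ... | inj₂ (there ())
  covers-xₔ : ∀ {n} (s : Fin n → Shape) σ → JoinedAlong s σ → CutsFirst s σ → ¬ CutsLast s σ →
              Covers s (map (rung s σ) (allFin n)) (xₔ s)
  covers-xₔ {zero}  s σ joined cf ¬cl = contradiction (cong axis cf) ¬cl
  covers-xₔ {suc n} s σ joined cf ¬cl = covered s σ joined (xₔ s) (fromℕ n)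
    (subst (λ v → Incident s v (rung s σ (fromℕ n)))
           (sym (trans (bottom-last s c) (cong (λ δ → corner δ (fromℕ (suc n))) (sym σₙ))))
           (inner-top s σ joined (fromℕ n)))
    where
    c : Axis
    c = cutAxis (suc (suc n))
    σₙ : σ (fromℕ (suc n)) ≡ flip (direction c)
    σₙ = ≢⇒≡flip λ eq → ¬cl (trans (cong axis eq) (axis-direction c))

module _ {n : ℕ} (s : Fin n → Shape) where

  Cut : (Fin (suc n) → Direction) → Set
  Cut σ = CutsFirst s σ ⊎ CutsLast s σ

  path-good : ∀ {σ} → JoinedAlong s σ → Cut σ → Good s (path s σ)
  path-good {σ} joined cut =
    path-perfect s σ joined , Sum.map (cutsFirst⇒a₁∈path s σ) (cutsLast⇒a′∈path s σ) cut , sameSide cut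
    where
    sameSide : Cut σ → SameSide s (descend (path s σ))
    sameSide c with cutsLast? s σ
    sameSide _         | yes cl = sameSide-cutsLast s σ joined cl
    sameSide (inj₁ cf) | no ¬cl = sameSide-cutsFirst s σ joined cf ¬cl
    sameSide (inj₂ cl) | no ¬cl = contradiction cl ¬cl

  good⇒path : ∀ {P} → Good s P → P ⊆ edges n → ∃ λ σ → JoinedAlong s σ × Cut σ × P ≡ path s σ
  good⇒path (perfect , cut , _) P⊆ = transfer cut (perfect⇒∃path s perfect P⊆)
    where
    transfer : ∀ {P} → a₁ ∈ P ⊎ a′ ∈ P → (∃ λ σ → JoinedAlong s σ × P ≡ path s σ) →
               ∃ λ σ → JoinedAlong s σ × Cut σ × P ≡ path s σ
    transfer cut (σ , joined , refl) =
      σ , joined , Sum.map (a₁∈path⇒cutsFirst s σ) (a′∈path⇒cutsLast s σ) cut , refl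

-- Listing the good matchings by sequences of directions

-- Vectors and not functions, so that sequences with equal entries are equal and a list of all of
-- them can be free of repetitions.
directionVecs : ∀ n → List (Vec Direction n)
directionVecs zero    = [] ∷ []
directionVecs (suc n) = map (up ∷_) (directionVecs n) ++ map (down ∷_) (directionVecs n)

∈-directionVecs : ∀ {n} (v : Vec Direction n) → v ∈ directionVecs n
∈-directionVecs []         = here refl
∈-directionVecs (up ∷ v)   = ∈-++⁺ˡ (∈-map⁺ (up ∷_) (∈-directionVecs v))
∈-directionVecs (down ∷ v) = ∈-++⁺ʳ (map (up ∷_) (directionVecs _)) (∈-map⁺ (down ∷_) (∈-directionVecs v))

directionVecs-unique : ∀ n → Unique (directionVecs n)
directionVecs-unique zero    = [] ∷ []
directionVecs-unique (suc n) = Unique.++⁺ (unique-∷ up) (unique-∷ down) disjoint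
  where
  unique-∷ : ∀ δ → Unique (map (δ ∷_) (directionVecs n))
  unique-∷ δ = Unique.map⁺ (λ { refl → refl }) (directionVecs-unique n)
  disjoint : ∀ {v} → ¬ (v ∈ map (up ∷_) (directionVecs n) × v ∈ map (down ∷_) (directionVecs n))
  disjoint (p , q) with ∈-map⁻ (up ∷_) p | ∈-map⁻ (down ∷_) q
  ... | _ , _ , refl | _ , _ , ()

-- Injectivity is asked only on members of the list, since directions can be recovered from `path`
-- only for joined sequences.
map-unique : ∀ {a b} {A : Set a} {B : Set b} {f : A → B} {xs : List A} →
             (∀ {x y} → x ∈ xs → y ∈ xs → f x ≡ f y → x ≡ y) → Unique xs → Unique (map f xs)
map-unique inj []       = []
map-unique inj (x∉ ∷ u) =
  All.map⁺ (All.tabulate λ y∈ eq → All.lookup x∉ y∈ (inj (here refl) (there y∈) eq))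
  ∷ map-unique (λ x∈ y∈ → inj (there x∈) (there y∈)) u

lookup-injective : ∀ {a} {A : Set a} {n} (v w : Vec A n) → (∀ k → lookup v k ≡ lookup w k) → v ≡ w
lookup-injective v w eq = trans (sym (tabulate∘lookup v)) (trans (tabulate-cong eq) (tabulate∘lookup w))

module _ {n : ℕ} (s : Fin n → Shape) where

  joined? : ∀ s δ δ′ → Dec (Joined s δ δ′)
  joined? s δ δ′ = (_ ≟ᴰ δ) ×-dec (_ ≟ᴰ δ′)

  Admissible : (Fin (suc n) → Direction) → Set
  Admissible σ = JoinedAlong s σ × Cut s σ

  admissible? : ∀ σ → Dec (Admissible σ)
  admissible? σ = all? (λ j → joined? (s j) (σ (inject₁ j)) (σ (suc j)))
    ×-dec (cutsFirst? s σ ⊎-dec cutsLast? s σ)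

  module _ {σ τ : Fin (suc n) → Direction} (eq : ∀ k → σ k ≡ τ k) where

    path-cong : path s σ ≡ path s τ
    path-cong rewrite eq zero | eq (fromℕ n) =
      cong (λ es → first (axis (τ zero)) ∷ es ++ last (axis (τ (fromℕ n))) ∷ [])
        (map-cong (λ j → cong₂ (λ δ δ′ → inner j (role (s j) δ δ′)) (eq (inject₁ j)) (eq (suc j))) (allFin n))

    admissible-resp : Admissible σ → Admissible τ
    admissible-resp (joined , cut) = joined′ , Sum.map (trans (sym (eq zero)))
      (trans (cong axis (sym (eq (fromℕ n))))) cut
      where
      joined′ : JoinedAlong s τ
      joined′ j rewrite sym (eq (inject₁ j)) | sym (eq (suc j)) = joined j

  pathOf : Vec Direction (suc n) → List (Edge n)
  pathOf v = path s (lookup v)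

  admissibleVecs : List (Vec Direction (suc n))
  admissibleVecs = filter (λ v → admissible? (lookup v)) (directionVecs (suc n))

  -- Two duplicate-free lists with the same members are permutations of each other, which is enough
  -- for a sum in a commutative ring and spares any comparison of their orders.
  goodMatchings-↭ : goodMatchings s ↭ map pathOf admissibleVecs
  goodMatchings-↭ = ∼bag⇒↭ (unique∧set⇒bag
    (Unique.filter⁺ (good? s) (sublists-unique (edges-unique n)))
    (map-unique injective (Unique.filter⁺ _ (directionVecs-unique (suc n))))
    (λ {P} → mk⇔ to from))
    where
    admissible : ∀ {v} → v ∈ admissibleVecs → Admissible (lookup v)
    admissible v∈ = proj₂ (∈-filter⁻ (λ v → admissible? (lookup v)) {xs = directionVecs (suc n)} v∈)
    injective : ∀ {v w} → v ∈ admissibleVecs → w ∈ admissibleVecs → pathOf v ≡ pathOf w → v ≡ w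
    injective {v} {w} v∈ w∈ eq = lookup-injective v w
      (path-injective s {lookup v} {lookup w} (proj₁ (admissible v∈)) (proj₁ (admissible w∈)) eq)
    listed : ∀ {P} → (∃ λ σ → JoinedAlong s σ × Cut s σ × P ≡ path s σ) → P ∈ map pathOf admissibleVecs
    listed (σ , joined , cut , refl) =
      subst (_∈ map pathOf admissibleVecs) (path-cong (lookup∘tabulate σ))
        (∈-map⁺ pathOf (∈-filter⁺ (λ v → admissible? (lookup v)) (∈-directionVecs (tabulate σ))
          (admissible-resp (λ k → sym (lookup∘tabulate σ k)) (joined , cut))))
    to : ∀ {P} → P ∈ goodMatchings s → P ∈ map pathOf admissibleVecs
    to {P} P∈ = listed (good⇒path s (proj₂ P∈′) (sublists-sound (edges n) (proj₁ P∈′)))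
      where
      P∈′ : P ∈ sublists (edges n) × Good s P
      P∈′ = ∈-filter⁻ (good? s) {xs = sublists (edges n)} P∈
    from : ∀ {P} → P ∈ map pathOf admissibleVecs → P ∈ goodMatchings s
    from P∈ with ∈-map⁻ pathOf P∈
    ... | v , v∈ , refl = ∈-filter⁺ (good? s)
      (sublists-complete (path-⊆-edges s (lookup v)))
      (path-good s {lookup v} (proj₁ (admissible v∈)) (proj₂ (admissible v∈)))

-- Sums of products along sequences of directions

module Sums {c ℓ} (R : CommutativeRing c ℓ) where

  open CommutativeRing R hiding (zero)
    renaming (refl to ≈-refl; sym to ≈-sym; trans to ≈-trans)
  open NatSolver commutativeSemiring using (solve; _:=_; _:+_; _:*_; con)
  open import Relation.Binary.Reasoning.Setoid setoid

  sum product : List Carrier → Carrier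
  sum     = foldr _+_ 0#
  product = foldr _*_ 1#

  ∏ : ∀ {n} → (Fin n → Carrier) → Carrier
  ∏ f = product (map f (allFin _))

  module _ {a} {A : Set a} where

    sum-↭ : (f : A → Carrier) {xs ys : List A} → xs ↭ ys → sum (map f xs) ≈ sum (map f ys)
    sum-↭ f ↭.refl        = ≈-refl
    sum-↭ f (prep x p)      = +-congˡ (sum-↭ f p)
    sum-↭ f (swap {xs} {ys} x y p) = begin
      f x + (f y + sum (map f xs)) ≈⟨ +-congˡ (+-congˡ (sum-↭ f p)) ⟩
      f x + (f y + sum (map f ys)) ≈⟨ solve 3 (λ a b s → a :+ (b :+ s) := b :+ (a :+ s)) ≈-refl _ _ _ ⟩
      f y + (f x + sum (map f ys)) ∎
    sum-↭ f (↭.trans p q) = ≈-trans (sum-↭ f p) (sum-↭ f q)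

    sum-cong : {f g : A → Carrier} → (∀ v → f v ≈ g v) → ∀ xs → sum (map f xs) ≈ sum (map g xs)
    sum-cong eq []       = ≈-refl
    sum-cong eq (x ∷ xs) = +-cong (eq x) (sum-cong eq xs)

    sum-map-++ : ∀ {b} {B : Set b} (f : A → Carrier) (h k : B → A) xs ys →
                 sum (map f (map h xs ++ map k ys)) ≈ sum (map (f ∘ h) xs) + sum (map (f ∘ k) ys)
    sum-map-++ f h k []       []       = ≈-sym (+-identityˡ 0#)
    sum-map-++ f h k []       (y ∷ ys) =
      ≈-trans (+-congˡ (≈-trans (sum-map-++ f h k [] ys) (+-identityˡ _))) (≈-sym (+-identityˡ _))
    sum-map-++ f h k (x ∷ xs) ys       = ≈-trans (+-congˡ (sum-map-++ f h k xs ys)) (≈-sym (+-assoc _ _ _))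

    sum-*ˡ : ∀ r (f : A → Carrier) xs → sum (map (λ v → r * f v) xs) ≈ r * sum (map f xs)
    sum-*ˡ r f []       = ≈-sym (zeroʳ r)
    sum-*ˡ r f (x ∷ xs) = ≈-trans (+-congˡ (sum-*ˡ r f xs)) (≈-sym (distribˡ r _ _))

    product-cong : {f g : A → Carrier} → (∀ v → f v ≈ g v) →
                   ∀ xs → product (map f xs) ≈ product (map g xs)
    product-cong eq []       = ≈-refl
    product-cong eq (x ∷ xs) = *-cong (eq x) (product-cong eq xs)

    product-* : (f g : A → Carrier) → ∀ xs →
                product (map (λ v → f v * g v) xs) ≈ product (map f xs) * product (map g xs)
    product-* f g []       = ≈-sym (*-identityˡ 1#)
    product-* f g (x ∷ xs) = ≈-trans (*-congˡ (product-* f g xs))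
      (solve 4 (λ a b p q → (a :* b) :* (p :* q) := (a :* p) :* (b :* q)) ≈-refl _ _ _ _)

    product-∷ʳ : (f : A → Carrier) → ∀ xs y → product (map f (xs ++ y ∷ [])) ≈ product (map f xs) * f y
    product-∷ʳ f []       y = *-comm _ _
    product-∷ʳ f (x ∷ xs) y = ≈-trans (*-congˡ (product-∷ʳ f xs y)) (≈-sym (*-assoc _ _ _))

    module _ {p} {P : Pred A p} (P? : Decidable P) where

      -- Turns a sum over admissible sequences into one over all sequences, with a weight `g` that
      -- vanishes on the others; only an unrestricted sum factors tile by tile.
      sum-filter : {f g : A → Carrier} → (∀ v → P v → f v ≈ g v) → (∀ v → ¬ P v → g v ≈ 0#) →
                   ∀ xs → sum (map f (filter P? xs)) ≈ sum (map g xs)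
      sum-filter eq vanish []       = ≈-refl
      sum-filter eq vanish (x ∷ xs) with P? x
      ... | yes px = +-cong (eq x px) (sum-filter eq vanish xs)
      ... | no ¬px = 
        ≈-trans (sum-filter eq vanish xs) (≈-trans (≈-sym (+-identityˡ _)) (+-congʳ (≈-sym (vanish x ¬px))))

      product-filter : {f g : A → Carrier} → (∀ v → P v → f v ≈ g v) → (∀ v → ¬ P v → g v ≈ 1#) →
                       ∀ xs → product (map f (filter P? xs)) ≈ product (map g xs)
      product-filter eq one []       = ≈-refl
      product-filter eq one (x ∷ xs) with P? x
      ... | yes px = *-cong (eq x px) (product-filter eq one xs)
      ... | no ¬px = 
          ≈-trans (product-filter eq one xs) (≈-trans (≈-sym (*-identityˡ _)) (*-congʳ (≈-sym (one x ¬px))))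

  ∏-suc : ∀ {n} (f : Fin (suc n) → Carrier) → ∏ f ≡ f zero * ∏ (f ∘ suc)
  ∏-suc f = cong (λ es → f zero * product es)
    (trans (map-tabulate suc f) (sym (map-tabulate id (f ∘ suc))))

  ∏-last : ∀ {n} (f : Fin (suc n) → Carrier) → ∏ f ≈ ∏ (f ∘ inject₁) * f (fromℕ n)
  ∏-last {zero}  f = *-comm _ _
  ∏-last {suc n} f = begin
    ∏ f                                              ≡⟨ ∏-suc f ⟩
    f zero * ∏ (f ∘ suc)                             ≈⟨ *-congˡ (∏-last (f ∘ suc)) ⟩
    f zero * (∏ (f ∘ suc ∘ inject₁) * f (fromℕ _))   ≈⟨ *-assoc _ _ _ ⟨
    f zero * ∏ (f ∘ suc ∘ inject₁) * f (fromℕ _)     ≡⟨ cong (_* f (fromℕ _)) (∏-suc (f ∘ inject₁)) ⟨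
    ∏ (f ∘ inject₁) * f (fromℕ _)                    ∎

  ∏-zero : ∀ {n} (f : Fin n → Carrier) j → f j ≈ 0# → ∏ f ≈ 0#
  ∏-zero f zero    eq = ≈-trans (*-congʳ eq) (zeroˡ _)
  ∏-zero f (suc j) eq = ≈-trans (reflexive (∏-suc f)) (≈-trans (*-congˡ (∏-zero (f ∘ suc) j eq)) (zeroʳ _))

  Transfer : Set c
  Transfer = Direction → Direction → Carrier

  ∑ : (Direction → Carrier) → Carrier
  ∑ f = f up + f down

  ∑-cong : ∀ {f g} → (∀ δ → f δ ≈ g δ) → ∑ f ≈ ∑ g
  ∑-cong eq = +-cong (eq up) (eq down)

  ∑-*ˡ : ∀ r f → ∑ (λ δ → r * f δ) ≈ r * ∑ f
  ∑-*ˡ r f = ≈-sym (distribˡ r (f up) (f down))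

  δ[_,_] : Transfer
  δ[ up   , up   ] = 1#
  δ[ up   , down ] = 0#
  δ[ down , up   ] = 0#
  δ[ down , down ] = 1#

  -- An entry of the product of all transfer matrices, indexed by the initial and the final
  -- direction.
  between : ∀ {n} → (Fin n → Transfer) → Transfer
  between {zero}  t δ ε = δ[ δ , ε ]
  between {suc n} t δ ε = ∑ λ δ′ → t zero δ δ′ * between (t ∘ suc) δ′ ε

  along : ∀ {n} → (Fin n → Transfer) → Vec Direction (suc n) → Carrier
  along t v = ∏ λ j → t j (lookup v (inject₁ j)) (lookup v (suc j))

  sum-directionVecs : ∀ {n} (f : Vec Direction (suc n) → Carrier) →
    sum (map f (directionVecs (suc n))) ≈ ∑ λ δ → sum (map (λ w → f (δ ∷ w)) (directionVecs n))
  sum-directionVecs f = sum-map-++ f (up ∷_) (down ∷_) (directionVecs _) (directionVecs _)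

  sum-along-from : ∀ {n} (t : Fin n → Transfer) (ψ : Direction → Carrier) δ →
    sum (map (λ w → ψ (lookup (δ ∷ w) (fromℕ n)) * along t (δ ∷ w)) (directionVecs n)) ≈
    ∑ λ ε → ψ ε * between t δ ε
  sum-along-from {zero}  t ψ up   = solve 2 (λ a b → a :* con 1 :+ con 0 := a :* con 1 :+ b :* con 0) ≈-refl _ _
  sum-along-from {zero}  t ψ down = solve 2 (λ a b → b :* con 1 :+ con 0 := a :* con 0 :+ b :* con 1) ≈-refl _ _
  sum-along-from {suc n} t ψ δ = begin
    sum (map (λ w → ψ (lookup (δ ∷ w) (fromℕ (suc n))) * along t (δ ∷ w)) (directionVecs (suc n)))
      ≈⟨ sum-directionVecs (λ w → ψ (lookup (δ ∷ w) (fromℕ (suc n))) * along t (δ ∷ w)) ⟩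
    (∑ λ δ′ → sum (map (λ w → ψ (lookup (δ′ ∷ w) (fromℕ n)) * along t (δ ∷ δ′ ∷ w)) (directionVecs n)))
      ≈⟨ ∑-cong step ⟩
    (∑ λ δ′ → t zero δ δ′ * ∑ λ ε → ψ ε * between (t ∘ suc) δ′ ε)
      -- Exchanges the sum over the second direction with the sum over the last.
      ≈⟨ solve 8 (λ a b p q u v w z → a :* (p :* u :+ q :* v) :+ b :* (p :* w :+ q :* z)
                 := p :* (a :* u :+ b :* w) :+ q :* (a :* v :+ b :* z)) ≈-refl _ _ _ _ _ _ _ _ ⟩
    (∑ λ ε → ψ ε * between t δ ε) ∎
    where
    step : ∀ δ′ → sum (map (λ w → ψ (lookup (δ′ ∷ w) (fromℕ n)) * along t (δ ∷ δ′ ∷ w)) (directionVecs n))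
                ≈ t zero δ δ′ * ∑ λ ε → ψ ε * between (t ∘ suc) δ′ ε
    step δ′ = begin
      sum (map (λ w → ψ (lookup (δ′ ∷ w) (fromℕ n)) * along t (δ ∷ δ′ ∷ w)) (directionVecs n))
        ≈⟨ sum-cong (λ w → ≈-trans
             (*-congˡ (reflexive (∏-suc λ j → t j (lookup (δ ∷ δ′ ∷ w) (inject₁ j)) (lookup (δ′ ∷ w) j))))
             (solve 3 (λ a b c → a :* (b :* c) := b :* (a :* c)) ≈-refl _ _ _)) (directionVecs n) ⟩
      sum (map (λ w → t zero δ δ′ * (ψ (lookup (δ′ ∷ w) (fromℕ n)) * along (t ∘ suc) (δ′ ∷ w))) (directionVecs n))
        ≈⟨ sum-*ˡ (t zero δ δ′) (λ w → ψ (lookup (δ′ ∷ w) (fromℕ n)) * along (t ∘ suc) (δ′ ∷ w))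
             (directionVecs n) ⟩
      t zero δ δ′ * sum (map (λ w → ψ (lookup (δ′ ∷ w) (fromℕ n)) * along (t ∘ suc) (δ′ ∷ w)) (directionVecs n))
        ≈⟨ *-congˡ (sum-along-from (t ∘ suc) ψ δ′) ⟩
      t zero δ δ′ * (∑ λ ε → ψ ε * between (t ∘ suc) δ′ ε) ∎

  sum-along : ∀ {n} (t : Fin n → Transfer) (φ : Transfer) →
    sum (map (λ v → φ (lookup v zero) (lookup v (fromℕ n)) * along t v) (directionVecs (suc n))) ≈
    ∑ λ δ → ∑ λ ε → φ δ ε * between t δ ε
  sum-along {n} t φ = ≈-trans
    (sum-directionVecs (λ v → φ (lookup v zero) (lookup v (fromℕ n)) * along t v))
    (∑-cong λ δ → sum-along-from t (φ δ) δ)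

-- Transfer matrices

-- Swapping `up` and `down` on the even tiles makes `up` the first and `down` the
-- second index of the matrices.
align : Parity → Direction → Direction
align 1ℙ δ = δ
align 0ℙ δ = flip δ

tileParity : ∀ {n} → Fin n → Parity
tileParity k = parity (suc (toℕ k))

tileParity-inject₁ : ∀ {n} (j : Fin n) → tileParity (inject₁ j) ≡ tileParity j
tileParity-inject₁ j = cong (λ m → parity (suc m)) (toℕ-inject₁ j)

tileParity-suc : ∀ {n} (j : Fin n) → tileParity (suc j) ≡ tileParity j ⁻¹
tileParity-suc j = sym (⁻¹-selfInverse (suc-homo-⁻¹ (suc (toℕ j))))

-- The parity of `d` in the end labels is absorbed by the swap: on the last tile, as on the first,
-- using the cut edge means aligned direction `up`.
cutAxis-align : ∀ m → cutAxis m ≡ axis (align (parity m) up)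
cutAxis-align m with parity m
... | 1ℙ = refl
... | 0ℙ = refl

signDirection : Sign → Direction
signDirection Sign.+ = down
signDirection Sign.- = up

-- The exchange of `up` and `down` between odd and even tiles in the definition of 𝓛-orientation is
-- the same swap, so after alignment only the sign matters.
𝓛-direction-align : ∀ {n} (b : Fin (suc n) → Sign) k →
                    𝓛-direction b k ≡ align (tileParity k) (signDirection (b k))
𝓛-direction-align b k with parity (suc (toℕ k)) | b k
... | 1ℙ | Sign.+ = refl
... | 1ℙ | Sign.- = refl
... | 0ℙ | Sign.+ = refl
... | 0ℙ | Sign.- = refl

typeOf : Parity → Shape → MatrixType
typeOf 1ℙ north = type₁
typeOf 1ℙ east  = type₂
typeOf 0ℙ north = type₂
typeOf 0ℙ east  = type₁

matrixType-typeOf : ∀ {n} (s : Fin n → Shape) j → matrixType s j ≡ typeOf (tileParity j) (s j)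
matrixType-typeOf s j with parity (suc (toℕ j)) | s j
... | 1ℙ | north = refl
... | 1ℙ | east  = refl
... | 0ℙ | north = refl
... | 0ℙ | east  = refl

-- Weights of matchings as products of transfers

module _ {c ℓ ℓ′} (R : CommutativeRing c ℓ) {Label : Set ℓ′} {n : ℕ}
  (B : OneSidedBand Label n) (b : Fin (suc n) → Sign)
  (x y : Label → CommutativeRing.Carrier R)
  (x-inv : ∀ j → Invertible (CommutativeRing._≈_ R) (CommutativeRing.1# R)
                   (CommutativeRing._*_ R) (x (OneSidedBand.diag B j)))
  where

  open CommutativeRing R hiding (zero)
    renaming (refl to ≈-refl; sym to ≈-sym; trans to ≈-trans)
  open OneSidedBand B
  open Enumerator R B b x y x-inv
  open Sums R hiding (sum; product)
  open NatSolver commutativeSemiring using (solve; _:=_; _:+_; _:*_; con)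
  open import Relation.Binary.Reasoning.Setoid setoid

  -- The value `0#` on the pair that no side joins makes every sequence that is not a matching
  -- contribute nothing.
  roleWeight : (Role → Carrier) → Shape → Transfer
  roleWeight w s δ δ′ = if does (joined? shape s δ δ′) then w (role s δ δ′) else 0#

  roleWeight-joined : ∀ w s {δ δ′} → Joined s δ δ′ → roleWeight w s δ δ′ ≡ w (role s δ δ′)
  roleWeight-joined w s {δ} {δ′} p =
    cong (if_then w (role s δ δ′) else 0#) (dec-true (joined? shape s δ δ′) p)

  roleWeight-disjoint : ∀ w s {δ δ′} → ¬ Joined s δ δ′ → roleWeight w s δ δ′ ≡ 0#
  roleWeight-disjoint w s {δ} {δ′} ¬p =
    cong (if_then w (role s δ δ′) else 0#) (dec-false (joined? shape s δ δ′) ¬p)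

  yFactor : Fin (suc n) → Direction → Carrier
  yFactor k δ = if does (δ ≟ᴰ 𝓛-direction b k) then yᵢ k else 1#

  -- Each transfer carries the y-factor of the tile it leaves, as m_j carries y_{i_j}. The y-factor
  -- of the last tile is left to `closing`.
  step : Fin n → Transfer
  step j δ δ′ = roleWeight (λ r → x (label B (inner j r))) (shape j) δ δ′ * yFactor (inject₁ j) δ

  -- The label of the end edge surviving `descend`, by the direction on G_1 and whether `a′` is
  -- used: `b` counted once if both `a` and `a′` are used, the far edge i_1 if only `a` is, the near
  -- edge i_d if only `a′` is, and weight zero if neither is, since the matching is then not good.
  cutWeight : Direction → Bool → Carrier
  cutWeight up   true  = x cut
  cutWeight up   false = x (diag zero)
  cutWeight down true  = x (diag (fromℕ n))
  cutWeight down false = 0#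

  cutWeight-uncut : ∀ {p} {P : Set p} δ (P? : Dec P) → ¬ (δ ≡ up ⊎ P) → cutWeight δ (does P?) ≡ 0#
  cutWeight-uncut up   _       ¬cut = contradiction (inj₁ refl) ¬cut
  cutWeight-uncut down (yes p) ¬cut = contradiction (inj₂ p) ¬cut
  cutWeight-uncut down (no _)  _    = refl

  closing : Transfer
  closing δ ε = cutWeight δ (does (axis ε ≟ᴬ cutAxis (suc n))) * yFactor (fromℕ n) ε

  module _ {σ : Fin (suc n) → Direction} (joined : JoinedAlong shape σ) where

    yWeight-path : yWeight (path shape σ) ≈ ∏ (λ k → yFactor k (σ k))
    yWeight-path = product-filter
      (λ k → (k , 𝓛-direction b k) ∈ᴰ? alternatingPath shape (path shape σ))
      oriented unoriented (allFin (suc n))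
      where
      oriented : ∀ k → _ → yᵢ k ≈ yFactor k (σ k)
      oriented k p with σ k ≟ᴰ 𝓛-direction b k
      ... | yes _ = ≈-refl
      ... | no ne = contradiction (sym (alternatingPath-sound shape {σ} joined p)) ne
      unoriented : ∀ k → ¬ _ → yFactor k (σ k) ≈ 1#
      unoriented k ¬p with σ k ≟ᴰ 𝓛-direction b k
      ... | no _  = ≈-refl
      ... | yes eq = contradiction (subst (λ δ → (k , δ) ∈ alternatingPath shape (path shape σ)) eq
                       (alternatingPath-complete shape {σ} joined k)) ¬p

    rungWeight : Fin n → Carrier
    rungWeight j = roleWeight (λ r → x (label B (inner j r))) (shape j) (σ (inject₁ j)) (σ (suc j))

    rungWeight-joined : ∀ j → x (label B (rung shape σ j)) ≈ rungWeight j
    rungWeight-joined j =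
      reflexive (sym (roleWeight-joined (λ r → x (label B (inner j r))) (shape j) (joined j)))

    product-rungs : product (map (x ∘ label B) (map (rung shape σ) (allFin n))) ≈ ∏ rungWeight
    product-rungs = ≈-trans
      (reflexive (cong product (sym (map-∘ {g = x ∘ label B} {f = rung shape σ} (allFin n)))))
      (product-cong rungWeight-joined (allFin n))

    lastLabel-uncut : ∀ {c α} → α ≢ c → lastLabel B c α ≡ diag zero
    lastLabel-uncut {horizontal} {horizontal} ne = contradiction refl ne
    lastLabel-uncut {horizontal} {vertical}   ne = refl
    lastLabel-uncut {vertical}   {horizontal} ne = refl
    lastLabel-uncut {vertical}   {vertical}   ne = contradiction refl ne

    cutWeight-first : ∀ δ → x (label B (first (axis δ))) ≡ cutWeight δ true
    cutWeight-first up   = refl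
    cutWeight-first down = refl

    xWeight-path : Cut shape σ → xWeight (path shape σ) ≈
      cutWeight (σ zero) (does (axis (σ (fromℕ n)) ≟ᴬ cutAxis (suc n))) * ∏ rungWeight
    xWeight-path cut with axis (σ (fromℕ n)) ≟ᴬ cutAxis (suc n)
    xWeight-path cut | yes cl = begin
      product (map (x ∘ label B) (descend (path shape σ)))
        ≡⟨ cong (λ es → product (map (x ∘ label B) es)) (descend-cutsLast shape σ cl) ⟩
      x (label B (first (axis (σ zero)))) * product (map (x ∘ label B) (map (rung shape σ) (allFin n)))
        ≈⟨ *-cong (reflexive (cutWeight-first (σ zero))) product-rungs ⟩
      cutWeight (σ zero) true * ∏ rungWeight ∎
    xWeight-path (inj₂ cl) | no ¬cl = contradiction cl ¬cl
    xWeight-path (inj₁ cf) | no ¬cl = begin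
      product (map (x ∘ label B) (descend (path shape σ)))
        ≡⟨ cong (λ es → product (map (x ∘ label B) es)) (descend-cutsFirst shape σ cf ¬cl) ⟩
      product (map (x ∘ label B) (map (rung shape σ) (allFin n) ++ last (axis (σ (fromℕ n))) ∷ []))
        ≈⟨ product-∷ʳ (x ∘ label B) (map (rung shape σ) (allFin n)) (last (axis (σ (fromℕ n)))) ⟩
      product (map (x ∘ label B) (map (rung shape σ) (allFin n))) * x (label B (last (axis (σ (fromℕ n)))))
        ≈⟨ *-cong product-rungs (reflexive (trans (cong x (lastLabel-uncut ¬cl))
             (cong (λ δ → cutWeight δ false) (sym cf)))) ⟩
      ∏ rungWeight * cutWeight (σ zero) false
        ≈⟨ *-comm _ _ ⟩
      cutWeight (σ zero) false * ∏ rungWeight ∎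

    weight-path : Cut shape σ → xWeight (path shape σ) * yWeight (path shape σ) ≈
      closing (σ zero) (σ (fromℕ n)) * ∏ (λ j → step j (σ (inject₁ j)) (σ (suc j)))
    weight-path cut = begin
      xWeight (path shape σ) * yWeight (path shape σ)
        ≈⟨ *-cong (xWeight-path cut) (≈-trans yWeight-path (∏-last (λ k → yFactor k (σ k)))) ⟩
      w * ∏ rungWeight * (∏ Y * yFactor (fromℕ n) (σ (fromℕ n)))
        ≈⟨ solve 4 (λ a b c d → (a :* b) :* (c :* d) := (a :* d) :* (b :* c)) ≈-refl _ _ _ _ ⟩
      w * yFactor (fromℕ n) (σ (fromℕ n)) * (∏ rungWeight * ∏ Y)
        ≈⟨ *-congˡ (product-* rungWeight Y (allFin n)) ⟨
      closing (σ zero) (σ (fromℕ n)) * ∏ (λ j → step j (σ (inject₁ j)) (σ (suc j))) ∎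
      where
      w : Carrier
      w = cutWeight (σ zero) (does (axis (σ (fromℕ n)) ≟ᴬ cutAxis (suc n)))
      Y : Fin n → Carrier
      Y j = yFactor (inject₁ j) (σ (inject₁ j))

  -- Either some consecutive pair is not joined and its transfer vanishes, or the cut edge is
  -- avoided at both ends and the closing weight vanishes.
  weight-inadmissible : ∀ (σ : Fin (suc n) → Direction) → ¬ Admissible shape σ →
    closing (σ zero) (σ (fromℕ n)) * ∏ (λ j → step j (σ (inject₁ j)) (σ (suc j))) ≈ 0#
  weight-inadmissible σ ¬adm with all? (λ j → joined? shape (shape j) (σ (inject₁ j)) (σ (suc j)))
  ... | no ¬joined = ≈-trans (*-congˡ (∏-zero _ (proj₁ gap) (vanish (proj₂ gap)))) (zeroʳ _)
    where
    gap : ∃ λ j → ¬ Joined (shape j) (σ (inject₁ j)) (σ (suc j))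
    gap = ¬∀⟶∃¬ n _ (λ j → joined? shape (shape j) (σ (inject₁ j)) (σ (suc j))) ¬joined
    vanish : ∀ {j} → ¬ Joined (shape j) (σ (inject₁ j)) (σ (suc j)) → step j (σ (inject₁ j)) (σ (suc j)) ≈ 0#
    vanish {j} ¬p = ≈-trans
      (*-congʳ (reflexive (roleWeight-disjoint (λ r → x (label B (inner j r))) (shape j) ¬p))) (zeroˡ _)
  ... | yes joined = ≈-trans (*-congʳ (≈-trans (*-congʳ (reflexive
    (cutWeight-uncut (σ zero) (cutsLast? shape σ) (λ cut → ¬adm (joined , cut))))) (zeroˡ _))) (zeroˡ _)

  enumerator-between : goodMatchingEnumerator ≈ ∑ λ δ → ∑ λ ε → closing δ ε * between step δ ε
  enumerator-between = begin
    sum (map weight (goodMatchings shape))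
      ≈⟨ sum-↭ weight (goodMatchings-↭ shape) ⟩
    sum (map weight (map (pathOf shape) (admissibleVecs shape)))
      ≡⟨ cong sum (map-∘ {g = weight} {f = pathOf shape} (admissibleVecs shape)) ⟨
    sum (map (weight ∘ pathOf shape) (admissibleVecs shape))
      ≈⟨ sum-filter (λ v → admissible? shape (lookup v))
           (λ v adm → weight-path {lookup v} (proj₁ adm) (proj₂ adm))
           (λ v → weight-inadmissible (lookup v)) (directionVecs (suc n)) ⟩
    sum (map (λ v → closing (lookup v zero) (lookup v (fromℕ n)) * along step v) (directionVecs (suc n)))
      ≈⟨ sum-along step closing ⟩
    (∑ λ δ → ∑ λ ε → closing δ ε * between step δ ε) ∎
    where
    weight : List (Edge n) → Carrier
    weight P = xWeight P * yWeight P

  -- A transfer runs from its first to its second argument, hence from the column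
  -- to the row of a matrix acting on column vectors.
  entry : Matrix → Transfer
  entry (mat p q r s) up   up   = p
  entry (mat p q r s) down up   = q
  entry (mat p q r s) up   down = r
  entry (mat p q r s) down down = s

  -- The right factor is passed first, so the descending product m_{d-1} ... m_1 meets the tiles in
  -- ascending order.
  entry-· : ∀ A B τ ρ → entry (A · B) τ ρ ≈ ∑ λ υ → entry B τ υ * entry A υ ρ
  entry-· A B up   up   = +-cong (*-comm _ _) (*-comm _ _)
  entry-· A B up   down = +-cong (*-comm _ _) (*-comm _ _)
  entry-· A B down up   = +-cong (*-comm _ _) (*-comm _ _)
  entry-· A B down down = +-cong (*-comm _ _) (*-comm _ _)

  entry-I₂ : ∀ p τ ρ → δ[ align p τ , align p ρ ] ≡ entry I₂ τ ρ
  entry-I₂ 1ℙ up   up   = refl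
  entry-I₂ 1ℙ up   down = refl
  entry-I₂ 1ℙ down up   = refl
  entry-I₂ 1ℙ down down = refl
  entry-I₂ 0ℙ up   up   = refl
  entry-I₂ 0ℙ up   down = refl
  entry-I₂ 0ℙ down up   = refl
  entry-I₂ 0ℙ down down = refl

  ∑-align : ∀ p f → ∑ (f ∘ align p) ≈ ∑ f
  ∑-align 1ℙ f = ≈-refl
  ∑-align 0ℙ f = +-comm _ _

  -- A split of the factor z of a tile between the transfers from and to it.
  leaveGauge arriveGauge : Carrier → Direction → Carrier
  leaveGauge  z up   = z
  leaveGauge  z down = 1#
  arriveGauge z up   = 1#
  arriveGauge z down = z

  arrive*leave : ∀ z τ → arriveGauge z τ * leaveGauge z τ ≈ z
  arrive*leave z up   = *-identityˡ z
  arrive*leave z down = *-identityʳ z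

  gauged : Carrier → Carrier → Transfer → Transfer
  gauged z z′ e τ ρ = leaveGauge z τ * arriveGauge z′ ρ * e τ ρ

  -- At an inner tile the arriving and the leaving gauge belong to the same direction, so together
  -- they give `z` whatever that direction is. At the two ends one of them is missing; the factors
  -- on the left supply it, and the product of all `z` comes out.
  between-gauge : ∀ {k} (z : Fin (suc k) → Carrier) (p : Fin (suc k) → Parity)
    (t : Fin k → Transfer) (f : Fin k → Matrix) →
    (∀ j τ ρ → t j (align (p (inject₁ j)) τ) (align (p (suc j)) ρ) ≈
               gauged (z (inject₁ j)) (z (suc j)) (entry (f j)) τ ρ) →
    ∀ τ ρ → arriveGauge (z zero) τ * leaveGauge (z (fromℕ k)) ρ
              * between t (align (p zero) τ) (align (p (fromℕ k)) ρ)
            ≈ ∏ z * entry (descendingProduct f) τ ρ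
  between-gauge {zero} z p t f eq τ ρ rewrite entry-I₂ (p zero) τ ρ = diagonal τ ρ
    where
    diagonal : ∀ τ ρ → arriveGauge (z zero) τ * leaveGauge (z zero) ρ * entry I₂ τ ρ
                     ≈ ∏ z * entry I₂ τ ρ
    diagonal up   up   = solve 1 (λ a → con 1 :* a :* con 1 := a :* con 1 :* con 1) ≈-refl _
    diagonal up   down = ≈-trans (zeroʳ _) (≈-sym (zeroʳ _))
    diagonal down up   = ≈-trans (zeroʳ _) (≈-sym (zeroʳ _))
    diagonal down down = solve 1 (λ a → a :* con 1 :* con 1 := a :* con 1 :* con 1) ≈-refl _
  between-gauge {suc k} z p t f eq τ ρ = begin
    A * L * ∑ (λ δ → t zero (align (p zero) τ) δ * N δ)
      ≈⟨ *-congˡ (∑-align (p (suc zero)) (λ δ → t zero (align (p zero) τ) δ * N δ)) ⟨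
    A * L * ∑ (λ υ → T υ * N (align (p (suc zero)) υ))
      ≈⟨ ∑-*ˡ (A * L) (λ υ → T υ * N (align (p (suc zero)) υ)) ⟨
    (∑ λ υ → A * L * (T υ * N (align (p (suc zero)) υ)))
      ≈⟨ ∑-cong through ⟩
    (∑ λ υ → z zero * ∏ (z ∘ suc) * (entry (f zero) τ υ * entry D υ ρ))
      ≈⟨ ∑-*ˡ (z zero * ∏ (z ∘ suc)) (λ υ → entry (f zero) τ υ * entry D υ ρ) ⟩
    z zero * ∏ (z ∘ suc) * ∑ (λ υ → entry (f zero) τ υ * entry D υ ρ)
      ≈⟨ *-cong (reflexive (sym (∏-suc z))) (≈-sym (entry-· D (f zero) τ ρ)) ⟩
    ∏ z * entry (D · f zero) τ ρ ∎
    where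
    A L : Carrier
    A = arriveGauge (z zero) τ
    L = leaveGauge (z (fromℕ (suc k))) ρ
    N : Direction → Carrier
    N δ = between (t ∘ suc) δ (align (p (fromℕ (suc k))) ρ)
    D : Matrix
    D = descendingProduct (f ∘ suc)
    T : Direction → Carrier
    T υ = t zero (align (p zero) τ) (align (p (suc zero)) υ)
    through : ∀ υ → A * L * (T υ * N (align (p (suc zero)) υ))
                  ≈ z zero * ∏ (z ∘ suc) * (entry (f zero) τ υ * entry D υ ρ)
    through υ = begin
      A * L * (T υ * N (align (p (suc zero)) υ))
        ≈⟨ *-congˡ (*-congʳ (eq zero τ υ)) ⟩
      A * L * (leaveGauge (z zero) τ * arriveGauge (z (suc zero)) υ * entry (f zero) τ υ
                 * N (align (p (suc zero)) υ))
        -- Pairs the two gauges of the first tile and passes the arriving gauge of the second to the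
        -- induction hypothesis.
        ≈⟨ solve 6 (λ a l l′ a′ e n → a :* l :* (l′ :* a′ :* e :* n) := a :* l′ :* (a′ :* l :* n) :* e)
             ≈-refl _ _ _ _ _ _ ⟩
      A * leaveGauge (z zero) τ * (arriveGauge (z (suc zero)) υ * L * N (align (p (suc zero)) υ))
        * entry (f zero) τ υ
        ≈⟨ *-congʳ (*-cong (arrive*leave (z zero) τ)
             (between-gauge (z ∘ suc) (p ∘ suc) (t ∘ suc) (f ∘ suc) (eq ∘ suc) υ ρ)) ⟩
      z zero * (∏ (z ∘ suc) * entry D υ ρ) * entry (f zero) τ υ
        ≈⟨ solve 4 (λ a b c d → a :* (b :* c) :* d := a :* b :* (d :* c)) ≈-refl _ _ _ _ ⟩
      z zero * ∏ (z ∘ suc) * (entry (f zero) τ υ * entry D υ ρ) ∎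

  -- Comparison with the matrices m_j

  typeWeight : (Role → Carrier) → MatrixType → Transfer
  typeWeight w type₁ up   up   = w upper
  typeWeight w type₁ up   down = w common
  typeWeight w type₁ down up   = 0#
  typeWeight w type₁ down down = w lower
  typeWeight w type₂ up   up   = w lower
  typeWeight w type₂ up   down = 0#
  typeWeight w type₂ down up   = w common
  typeWeight w type₂ down down = w upper

  -- Exactly one of two neighbouring tiles is swapped, so the excluded pair of equal directions
  -- becomes one of unequal directions, the zero of a triangular matrix. Changing either the shape
  -- or the parity exchanges the two types.
  roleWeight-align : ∀ w p s τ ρ →
    roleWeight w s (align p τ) (align (p ⁻¹) ρ) ≡ typeWeight w (typeOf p s) τ ρ
  roleWeight-align w 1ℙ north up   up   = refl
  roleWeight-align w 1ℙ north up   down = refl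
  roleWeight-align w 1ℙ north down up   = refl
  roleWeight-align w 1ℙ north down down = refl
  roleWeight-align w 1ℙ east  up   up   = refl
  roleWeight-align w 1ℙ east  up   down = refl
  roleWeight-align w 1ℙ east  down up   = refl
  roleWeight-align w 1ℙ east  down down = refl
  roleWeight-align w 0ℙ north up   up   = refl
  roleWeight-align w 0ℙ north up   down = refl
  roleWeight-align w 0ℙ north down up   = refl
  roleWeight-align w 0ℙ north down down = refl
  roleWeight-align w 0ℙ east  up   up   = refl
  roleWeight-align w 0ℙ east  up   down = refl
  roleWeight-align w 0ℙ east  down up   = refl
  roleWeight-align w 0ℙ east  down down = refl

  signFactor : Carrier → Sign → Direction → Carrier
  signFactor z σ τ = if does (τ ≟ᴰ signDirection σ) then z else 1#

  yFactor-align : ∀ k τ → yFactor k (align (tileParity k) τ) ≡ signFactor (yᵢ k) (b k) τ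
  yFactor-align k τ = cong (if_then yᵢ k else 1#) (trans
    (cong (λ δ → does (align (tileParity k) τ ≟ᴰ δ)) (𝓛-direction-align b k))
    (≟ᴰ-align (tileParity k) τ (signDirection (b k))))
    where
    ≟ᴰ-align : ∀ p δ ε → does (align p δ ≟ᴰ align p ε) ≡ does (δ ≟ᴰ ε)
    ≟ᴰ-align 1ℙ δ    ε    = refl
    ≟ᴰ-align 0ℙ up   up   = refl
    ≟ᴰ-align 0ℙ up   down = refl
    ≟ᴰ-align 0ℙ down up   = refl
    ≟ᴰ-align 0ℙ down down = refl

  inverse : ∀ k → xᵢ k * 1/xᵢ k ≈ 1#
  inverse k = proj₂ (proj₂ (x-inv k))

  module _ (j : Fin n) where

    private
      u v u⁻ v⁻ a q : Carrier
      u  = xᵢ (inject₁ j)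
      v  = xᵢ (suc j)
      u⁻ = 1/xᵢ (inject₁ j)
      v⁻ = 1/xᵢ (suc j)
      a  = x (arc j)
      q  = yᵢ (inject₁ j)

      cancel : ∀ {r s} k → s ≈ r * (xᵢ k * 1/xᵢ k) → r ≈ s
      cancel k eq = ≈-sym (≈-trans eq (≈-trans (*-congˡ (inverse k)) (*-identityʳ _)))

    -- The gauges clear the denominators of m_j: they multiply the diagonal entries by x_{i_j} and
    -- x_{i_{j+1}} respectively, the lower left entry by both and the upper right one by neither.
    entry-mOf : ∀ t σ τ ρ →
      typeWeight (λ r → x (label B (inner j r))) t τ ρ * signFactor q σ τ ≈ gauged u v (entry (mOf t σ j)) τ ρ
    entry-mOf type₁ Sign.+ up   up   = solve 1 (λ u → u :* con 1 := u :* con 1 :* con 1) ≈-refl _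
    entry-mOf type₁ Sign.+ up   down = cancel (inject₁ j) (≈-trans
      (solve 5 (λ u v u⁻ v⁻ a → u :* v :* (a :* (u⁻ :* v⁻)) := a :* (v :* v⁻) :* (u :* u⁻)) ≈-refl u v u⁻ v⁻ a)
      -- The `1#` arising from `v * v⁻` is kept, since it serves as the trivial `signFactor` on the
      -- other side.
      (*-congʳ (*-congˡ (inverse (suc j)))))
    entry-mOf type₁ Sign.+ down up   = solve 1 (λ q → con 0 :* q := con 1 :* con 1 :* con 0) ≈-refl q
    entry-mOf type₁ Sign.+ down down = solve 2 (λ v q → v :* q := con 1 :* v :* q) ≈-refl v q
    entry-mOf type₁ Sign.- up   up   = solve 2 (λ u q → u :* q := u :* con 1 :* q) ≈-refl u q
    entry-mOf type₁ Sign.- up   down = cancel (inject₁ j) (≈-trans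
      (solve 6 (λ u v u⁻ v⁻ a q → u :* v :* (a :* q :* (u⁻ :* v⁻)) := (a :* q) :* (v :* v⁻) :* (u :* u⁻))
        ≈-refl u v u⁻ v⁻ a q)
      (*-congʳ (≈-trans (*-congˡ (inverse (suc j))) (*-identityʳ _))))
    entry-mOf type₁ Sign.- down up   = solve 0 (con 0 :* con 1 := con 1 :* con 1 :* con 0) ≈-refl
    entry-mOf type₁ Sign.- down down = solve 1 (λ v → v :* con 1 := con 1 :* v :* con 1) ≈-refl v
    entry-mOf type₂ Sign.+ up   up   = cancel (inject₁ j)
      (solve 3 (λ u u⁻ v → u :* con 1 :* (v :* u⁻) := v :* con 1 :* (u :* u⁻)) ≈-refl u u⁻ v)
    entry-mOf type₂ Sign.+ up   down = solve 2 (λ u v → con 0 :* con 1 := u :* v :* con 0) ≈-refl u v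
    entry-mOf type₂ Sign.+ down up   = solve 2 (λ a q → a :* q := con 1 :* con 1 :* (a :* q)) ≈-refl a q
    entry-mOf type₂ Sign.+ down down = cancel (suc j)
      (solve 4 (λ u v v⁻ q → con 1 :* v :* (u :* q :* v⁻) := u :* q :* (v :* v⁻)) ≈-refl u v v⁻ q)
    entry-mOf type₂ Sign.- up   up   = cancel (inject₁ j)
      (solve 4 (λ u u⁻ v q → u :* con 1 :* (v :* q :* u⁻) := v :* q :* (u :* u⁻)) ≈-refl u u⁻ v q)
    entry-mOf type₂ Sign.- up   down = solve 3 (λ u v q → con 0 :* q := u :* v :* con 0) ≈-refl u v q
    entry-mOf type₂ Sign.- down up   = solve 1 (λ a → a :* con 1 := con 1 :* con 1 :* a) ≈-refl a
    entry-mOf type₂ Sign.- down down = cancel (suc j)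
      (solve 3 (λ u v v⁻ → con 1 :* v :* (u :* v⁻) := u :* con 1 :* (v :* v⁻)) ≈-refl u v v⁻)

    step-align : ∀ τ ρ → step j (align (tileParity (inject₁ j)) τ) (align (tileParity (suc j)) ρ) ≈
                         gauged u v (entry (m j)) τ ρ
    step-align τ ρ = ≈-trans (reflexive (cong₂ _*_ weight (yFactor-align (inject₁ j) τ)))
      (≈-trans (entry-mOf (typeOf (tileParity j) (shape j)) (b (inject₁ j)) τ ρ)
        (reflexive (cong (λ t → gauged u v (entry (mOf t (b (inject₁ j)) j)) τ ρ)
          (sym (matrixType-typeOf shape j)))))
      where
      w : Role → Carrier
      w r = x (label B (inner j r))
      weight : roleWeight w (shape j) (align (tileParity (inject₁ j)) τ) (align (tileParity (suc j)) ρ)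
             ≡ typeWeight w (typeOf (tileParity j) (shape j)) τ ρ
      weight = trans
        (cong₂ (λ p p′ → roleWeight w (shape j) (align p τ) (align p′ ρ))
               (tileParity-inject₁ j) (tileParity-suc j))
        (roleWeight-align w (tileParity j) (shape j) τ ρ)

  -- Closing the band: the trace

  private
    d : Fin (suc n)
    d = fromℕ n

    -- Only the last direction is aligned explicitly: G_1 is an odd tile, where `align` is the
    -- identity.
    Z : Transfer
    Z τ ρ = between step τ (align (tileParity d) ρ)

  closing-align : ∀ δ ρ → closing δ (align (tileParity d) ρ) ≡
                          cutWeight δ (does (ρ ≟ᴰ up)) * signFactor (yᵢ d) (b d) ρ
  closing-align δ ρ = cong₂ _*_ (cong (cutWeight δ) (crosses ρ)) (yFactor-align d ρ)
    where
    crosses : ∀ ρ → does (axis (align (tileParity d) ρ) ≟ᴬ cutAxis (suc n)) ≡ does (ρ ≟ᴰ up)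
    -- The parity of the last tile becomes that of `d` through `toℕ-fromℕ`, so that one case split
    -- settles both.
    crosses ρ rewrite cutAxis-align (suc n) | toℕ-fromℕ n with parity (suc n) | ρ
    ... | 1ℙ | up   = refl
    ... | 1ℙ | down = refl
    ... | 0ℙ | up   = refl
    ... | 0ℙ | down = refl

  enumerator-aligned : ∀ {σ} → b d ≡ σ → goodMatchingEnumerator ≈
    ∑ λ τ → ∑ λ ρ → cutWeight τ (does (ρ ≟ᴰ up)) * signFactor (yᵢ d) σ ρ * Z τ ρ
  enumerator-aligned refl = ≈-trans enumerator-between (∑-cong λ τ → ≈-trans
    (≈-sym (∑-align (tileParity d) (λ ε → closing τ ε * between step τ ε)))
    (∑-cong λ ρ → *-cong (reflexive (closing-align τ ρ)) (≈-refl {Z τ ρ})))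

  Z-entry : ∀ τ ρ → arriveGauge (xᵢ zero) τ * leaveGauge (xᵢ d) ρ * Z τ ρ ≈ ∏ xᵢ * entry M τ ρ
  Z-entry = between-gauge xᵢ tileParity step m step-align

  -- The entries c are the closing weights divided by the two end gauges, indexed by first and last
  -- direction. Since `entry` runs from column to row, summing over both directions gives a trace.
  -- The entries are given only up to `≈` so that both signs, whose y-factor sits in different
  -- entries, are handled together.
  enumerator-trace : ∀ {σ c₁₁ c₁₂ c₂₁} → b d ≡ σ →
    c₁₁ ≈ x cut * signFactor (yᵢ d) σ up * 1/xᵢ d →
    c₁₂ ≈ xᵢ zero * signFactor (yᵢ d) σ down →
    c₂₁ ≈ signFactor (yᵢ d) σ up * 1/xᵢ zero →
    goodMatchingEnumerator ≈ ∏ xᵢ * tr (mat c₁₁ c₁₂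
                                            c₂₁ 0# · M)
  enumerator-trace {σ} {c₁₁} {c₁₂} {c₂₁} bd≡σ eq₁₁ eq₁₂ eq₂₁ = begin
    goodMatchingEnumerator
      ≈⟨ enumerator-aligned bd≡σ ⟩
    x cut * s * Z up up + xᵢ zero * s′ * Z up down + (xᵢ d * s * Z down up + 0# * s′ * Z down down)
      ≈⟨ +-cong (+-cong uu ud) (+-cong du (≈-trans (*-congʳ (zeroˡ _)) (zeroˡ _))) ⟩
    c₁₁ * (∏ xᵢ * entry M up up) + c₁₂ * (∏ xᵢ * entry M up down) + (c₂₁ * (∏ xᵢ * entry M down up) + 0#)
      ≈⟨ solve 8 (λ a b c p m₁₁ m₁₂ m₂₁ m₂₂ →
           a :* (p :* m₁₁) :+ b :* (p :* m₂₁) :+ (c :* (p :* m₁₂) :+ con 0)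
           := p :* (a :* m₁₁ :+ b :* m₂₁ :+ (c :* m₁₂ :+ con 0 :* m₂₂)))
           ≈-refl c₁₁ c₁₂ c₂₁ (∏ xᵢ)
           (entry M up up) (entry M down up) (entry M up down) (entry M down down) ⟩
    ∏ xᵢ * tr (mat c₁₁ c₁₂ c₂₁ 0# · M) ∎
    where
    s s′ : Carrier
    s   = signFactor (yᵢ d) σ up
    s′  = signFactor (yᵢ d) σ down
    uu : x cut * s * Z up up ≈ c₁₁ * (∏ xᵢ * entry M up up)
    uu = ≈-sym (begin
      c₁₁ * (∏ xᵢ * entry M up up)                ≈⟨ *-cong eq₁₁ (≈-sym (Z-entry up up)) ⟩
      x cut * s * 1/xᵢ d * (1# * xᵢ d * Z up up)
        ≈⟨ solve 4 (λ a i r z → a :* i :* (con 1 :* r :* z) := a :* z :* (r :* i)) ≈-refl _ _ _ _ ⟩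
      x cut * s * Z up up * (xᵢ d * 1/xᵢ d)        ≈⟨ *-congˡ (inverse d) ⟩
      x cut * s * Z up up * 1#                    ≈⟨ *-identityʳ _ ⟩
      x cut * s * Z up up                         ∎)
    ud : xᵢ zero * s′ * Z up down ≈ c₁₂ * (∏ xᵢ * entry M up down)
    ud = *-cong (≈-sym eq₁₂) (≈-trans (≈-sym (≈-trans (*-congʳ (*-identityˡ 1#)) (*-identityˡ _))) (Z-entry up down))
    du : xᵢ d * s * Z down up ≈ c₂₁ * (∏ xᵢ * entry M down up)
    du = ≈-sym (begin
      c₂₁ * (∏ xᵢ * entry M down up)              ≈⟨ *-cong eq₂₁ (≈-sym (Z-entry down up)) ⟩
      s * 1/xᵢ zero * (xᵢ zero * xᵢ d * Z down up)
        ≈⟨ solve 5 (λ s i a r z → s :* i :* (a :* r :* z) := r :* s :* z :* (a :* i)) ≈-refl _ _ _ _ _ ⟩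
      xᵢ d * s * Z down up * (xᵢ zero * 1/xᵢ zero)      ≈⟨ *-congˡ (inverse zero) ⟩
      xᵢ d * s * Z down up * 1#                    ≈⟨ *-identityʳ _ ⟩
      xᵢ d * s * Z down up                         ∎)

theorem6p4 :
  ∀ {c ℓ ℓ′} (R : CommutativeRing c ℓ) {Label : Set ℓ′} {n : ℕ}
    (B : OneSidedBand Label n) (b : Fin (suc n) → Sign) →
  let open CommutativeRing R hiding (zero)
      open OneSidedBand B in
  (x y : Label → Carrier)
  (x-inv : ∀ j → Invertible _≈_ 1# _*_ (x (diag j))) →
  let open Enumerator R B b x y x-inv
      d = fromℕ n in
  (b d ≡ Sign.+ →
    goodMatchingEnumerator ≈
      product (map xᵢ (allFin (suc n))) *
      tr (mat (x cut * 1/xᵢ d) (xᵢ zero * yᵢ d)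
              (1/xᵢ zero)      0#               · M))
  ×
  (b d ≡ Sign.- →
    goodMatchingEnumerator ≈
      product (map xᵢ (allFin (suc n))) *
      tr (mat (x cut * yᵢ d * 1/xᵢ d) (xᵢ zero)
              (yᵢ d * 1/xᵢ zero)      0#        · M))
theorem6p4 R B b x y x-inv =
  (λ eq → enumerator-trace R B b x y x-inv eq
    (*-congʳ (≈-sym (*-identityʳ _))) ≈-refl (≈-sym (*-identityˡ _))) ,
  (λ eq → enumerator-trace R B b x y x-inv eq ≈-refl (≈-sym (*-identityʳ _)) ≈-refl)
  where
  open CommutativeRing R
    using (*-congʳ; *-identityˡ; *-identityʳ) renaming (refl to ≈-refl; sym to ≈-sym)
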